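{- Let $u\ge \ell\ge 1$ and $m\ge 1$ be integers, let $n\coloneqq 2^\ell$, and let $\mathcal{H}$ be the set of all linear maps $\mathbb{F}_2^u\to\mathbb{F}_2^\ell$. For any $S\subset \mathbb{F}_2^u$ of cardinality $m$ and any real $r\ge 6$, if $h$ is drawn uniformly at random from $\mathcal{H}$, then \[\Pr_{h\sim \mathcal{H}}\left[\max_{y\in \mathbb{F}_2^\ell} |h^{ -1}(y)\cap S|\ge r\cdot \textsc{opt}(m,n)\right] \le \frac{49}{(r-2)^2}.\]
   Context: $\log$ denotes the base-2 logarithm. For positive integers $m,n$ define \[\textsc{opt}(m,n) = \begin{cases}\dfrac{\log n}{\log\left(\frac{n\log n}{m}\right)} & m\le \frac{1}{2}n\log n, \\[2mm] \dfrac{m}{n} & m > \frac{1}{2} n\log n.\end{cases}\]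
   Formalization: The parameter r ≥ 6 is taken rational, r = p/q, instead of real; the bound for real r follows by letting rationals increase to r, since the event is monotone in r and 49/(r−2)² is continuous. -}

module Defs where

open import Data.Bool using (Bool; true; false; _∧_; _xor_)
open import Data.Nat using (ℕ; zero; suc; _+_; _*_; _∸_; _^_; _≤_; _⊔_; _≤?_)
open import Data.Product using (_×_; _,_)
open import Data.List using (List; []; _∷_; map; concatMap; length; filter; foldr)
open import Data.Vec using (Vec; []; _∷_; zipWith)
import Data.Vec as V
open import Data.Vec.Properties using (≡-dec)
import Data.Bool.Properties as BP
open import Relation.Nullary using (Dec; yes; no)
open import Relation.Binary.PropositionalEquality using (_≡_)
open import Relation.Nullary.Decidable using (_×-dec_)

-- 𝔽₂ is modelled by Bool (false = 0, true = 1; addition = xor, multiplication = ∧).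
F2^ : ℕ → Set
F2^ n = Vec Bool n

allVecs : (n : ℕ) → List (F2^ n)
allVecs zero    = [] ∷ []
allVecs (suc n) = concatMap (λ b → map (b ∷_) (allVecs n)) (true ∷ false ∷ [])

-- A linear map 𝔽₂^u → 𝔽₂^ℓ is (uniquely) given by its ℓ × u matrix over 𝔽₂.
LinMap : ℕ → ℕ → Set
LinMap u ℓ = Vec (F2^ u) ℓ

allVecsOf : {A : Set} → List A → (n : ℕ) → List (Vec A n)
allVecsOf xs zero    = [] ∷ []
allVecsOf xs (suc n) = concatMap (λ a → map (a ∷_) (allVecsOf xs n)) xs

allLinMaps : (u ℓ : ℕ) → List (LinMap u ℓ)
allLinMaps u ℓ = allVecsOf (allVecs u) ℓ

dot : {n : ℕ} → F2^ n → F2^ n → Bool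
dot a x = V.foldr _ _xor_ false (zipWith _∧_ a x)

apply : {u ℓ : ℕ} → LinMap u ℓ → F2^ u → F2^ ℓ
apply h x = V.map (λ row → dot row x) h

_≟v_ : {n : ℕ} → (a b : F2^ n) → Dec (a ≡ b)
_≟v_ = ≡-dec BP._≟_

load : {u ℓ : ℕ} → LinMap u ℓ → List (F2^ u) → F2^ ℓ → ℕ
load h S y = length (filter (λ x → apply h x ≟v y) S)

maxLoad : {u ℓ : ℕ} → LinMap u ℓ → List (F2^ u) → ℕ
maxLoad {u} {ℓ} h S = foldr _⊔_ 0 (map (load h S) (allVecs ℓ))

-- "k ≥ r · opt(m, n)" with n = 2^ℓ (so log n = ℓ) and r = p / q (q ≥ 1),
-- written as an exact integer inequality (no reals needed):
--  * if 2m > 2^ℓ·ℓ  (i.e. m > ½ n log n): opt = m / 2^ℓ, and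
--      k ≥ (p/q)(m/2^ℓ)  ⇔  p·m ≤ k·q·2^ℓ ;
--  * if 2m ≤ 2^ℓ·ℓ: opt = ℓ / log(2^ℓ ℓ / m) with log(2^ℓ ℓ / m) ≥ 1 > 0, and
--      k ≥ (p/q)·ℓ / log(2^ℓ ℓ/m)  ⇔  (p/q)·ℓ ≤ k·log(2^ℓ ℓ/m)
--      ⇔ 2^{pℓ} ≤ (2^ℓ ℓ / m)^{kq}  ⇔  2^{pℓ} · m^{kq} ≤ (2^ℓ·ℓ)^{kq}.
AtLeastROpt : (k p q m ℓ : ℕ) → Set
AtLeastROpt k p q m ℓ with 2 * m ≤? 2 ^ ℓ * ℓ
... | yes _ = 2 ^ (p * ℓ) * m ^ (k * q) ≤ (2 ^ ℓ * ℓ) ^ (k * q)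
... | no  _ = p * m ≤ k * q * 2 ^ ℓ

atLeastROpt? : (k p q m ℓ : ℕ) → Dec (AtLeastROpt k p q m ℓ)
atLeastROpt? k p q m ℓ with 2 * m ≤? 2 ^ ℓ * ℓ
... | yes _ = 2 ^ (p * ℓ) * m ^ (k * q) ≤? (2 ^ ℓ * ℓ) ^ (k * q)
... | no  _ = p * m ≤? k * q * 2 ^ ℓ

badCount : (u ℓ : ℕ) → List (F2^ u) → (m p q : ℕ) → ℕ
badCount u ℓ S m p q =
  length (filter (λ h → atLeastROpt? (maxLoad h S) p q m ℓ) (allLinMaps u ℓ))

{-# OPTIONS --safe #-}
module Submission where

open import Defs
open import Algebra.Properties.CommutativeSemigroup using (interchange)
open import Data.Bool using (Bool; true; false; if_then_else_; not; _∧_; _xor_)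
import Data.Bool.Properties as Bool
open import Data.Nat using (ℕ; zero; suc; _+_; _*_; _∸_; _^_; _≤_; _<_; _⊔_; _⊓_; _≤?_; z≤n; s≤s; NonZero; >-nonZero)
open import Data.Nat.ListAction using (sum)
open import Data.Nat.ListAction.Properties using (sum-++)
open import Data.Nat.Properties
open import Data.Nat.Tactic.RingSolver using (solve-∀)
open import Data.List using (List; []; _∷_; _++_; concatMap; filter; foldr; length; map)
open import Data.List.Properties using (map-∘; map-++)
open import Data.List.Relation.Unary.All using (All; []; _∷_)
open import Data.List.Relation.Unary.AllPairs using ([]; _∷_)
open import Data.List.Relation.Unary.Unique.Propositional using (Unique)
open import Data.Product using (∃; _×_; _,_)
open import Data.Sum using (inj₁; inj₂; [_,_]′)
open import Data.Vec using (Vec; []; _∷_; zipWith)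
open import Function using (_∘_)
open import Relation.Binary.PropositionalEquality
open import Relation.Nullary using (Dec; yes; no; does; contradiction)
open import Relation.Unary using (Decidable)

-- Fix c > 1 and, for a linear map h into 𝔽₂^i, let X(h) = ∑_y (c^load(y) - 1); a bin of load k
-- forces X ≥ c^k - 1.  A uniform map into 𝔽₂^i is a uniform map h into 𝔽₂^(1+i) followed by
-- the quotient by a random line spanned by (1 , a), which merges the bins in pairs: this adds to
-- X an amount W ≥ 0 whose mean over a is at most X(h)² / 2^(i+2) by AM-GM.  Since
-- min(X + W, B)² ≤ X² + 2 B W for X ≤ B, one gets
--   E min(X_i / B , 1)² ≤ E min(X_(i+1) / B′ , 1)²   whenever   B′² (1 + B / 2^(i+1)) ≤ B².
-- Starting from B = 2^ℓ (2^(2^J) - 1) / 2 at i = ℓ, this recursion is satisfied by replacing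
-- E² - 1 with E - 1 (and 2^i with 2^(i+1)) until E = 2, and then by 2^i / (3·2^t - 1); so B stays
-- above 2^(ℓ+J) / 3 for all i.  For i = w → ∞ the map h is injective on S with probability tending
-- to 1, and then X = (c - 1) m.  Hence the tail probability is at most (3 (c - 1) m / 2^(ℓ+J))².
-- All quantities are cleared of denominators: c = cn / cd, and weights are scaled by cd^m.

private variable
  A B : Set
  i u : ℕ

-- Finite sums over lists and over the enumerations of vectors and matrices

∑ : List A → (A → ℕ) → ℕ
∑ xs f = sum (map f xs)

∑-cong : (xs : List A) {f g : A → ℕ} → (∀ x → f x ≡ g x) → ∑ xs f ≡ ∑ xs g
∑-cong []       f≗g = refl
∑-cong (x ∷ xs) f≗g = cong₂ _+_ (f≗g x) (∑-cong xs f≗g)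

∑-mono : (xs : List A) {f g : A → ℕ} → (∀ x → f x ≤ g x) → ∑ xs f ≤ ∑ xs g
∑-mono []       f≤g = z≤n
∑-mono (x ∷ xs) f≤g = +-mono-≤ (f≤g x) (∑-mono xs f≤g)

∑-const : (xs : List A) (c : ℕ) → ∑ xs (λ _ → c) ≡ length xs * c
∑-const []       c = refl
∑-const (x ∷ xs) c = cong (c +_) (∑-const xs c)

∑-+ : (xs : List A) (f g : A → ℕ) → ∑ xs (λ x → f x + g x) ≡ ∑ xs f + ∑ xs g
∑-+ []       f g = refl
∑-+ (x ∷ xs) f g = trans (cong (f x + g x +_) (∑-+ xs f g))
  (interchange +-commutativeSemigroup (f x) (g x) (∑ xs f) (∑ xs g))

∑-*ˡ : (xs : List A) (c : ℕ) (f : A → ℕ) → ∑ xs (λ x → c * f x) ≡ c * ∑ xs f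
∑-*ˡ []       c f = sym (*-zeroʳ c)
∑-*ˡ (x ∷ xs) c f = trans (cong (c * f x +_) (∑-*ˡ xs c f))
  (sym (*-distribˡ-+ c (f x) (∑ xs f)))

∑-*ʳ : (xs : List A) (f : A → ℕ) (c : ℕ) → ∑ xs (λ x → f x * c) ≡ ∑ xs f * c
∑-*ʳ xs f c = trans (∑-cong xs (λ x → *-comm (f x) c)) (trans (∑-*ˡ xs c f) (*-comm c _))

∑-swap : (xs : List A) (ys : List B) (f : A → B → ℕ) →
  ∑ xs (λ x → ∑ ys (f x)) ≡ ∑ ys (λ y → ∑ xs (λ x → f x y))
∑-swap []       ys f = sym (trans (∑-const ys 0) (*-zeroʳ (length ys)))
∑-swap (x ∷ xs) ys f = trans (cong (∑ ys (f x) +_) (∑-swap xs ys f))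
  (sym (∑-+ ys (f x) (λ y → ∑ xs (λ z → f z y))))

∑-++ : (xs ys : List A) (f : A → ℕ) → ∑ (xs ++ ys) f ≡ ∑ xs f + ∑ ys f
∑-++ xs ys f = trans (cong sum (map-++ f xs ys)) (sum-++ (map f xs) (map f ys))

∑-map : (φ : A → B) (xs : List A) (f : B → ℕ) → ∑ (map φ xs) f ≡ ∑ xs (f ∘ φ)
∑-map φ xs f = cong sum (sym (map-∘ xs))

∑-concatMap : (φ : A → List B) (xs : List A) (f : B → ℕ) →
  ∑ (concatMap φ xs) f ≡ ∑ xs (λ x → ∑ (φ x) f)
∑-concatMap φ []       f = refl
∑-concatMap φ (x ∷ xs) f = trans (∑-++ (φ x) (concatMap φ xs) f)
  (cong (∑ (φ x) f +_) (∑-concatMap φ xs f))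

∑-1 : (xs : List A) → ∑ xs (λ _ → 1) ≡ length xs
∑-1 xs = trans (∑-const xs 1) (*-identityʳ (length xs))

-- Markov's inequality, multiplied out by the number of outcomes.
length-filter-*-≤-∑ : {P : A → Set} (P? : Decidable P) (xs : List A) (T : A → ℕ) (c : ℕ) →
  (∀ x → P x → c ≤ T x) → length (filter P? xs) * c ≤ ∑ xs T
length-filter-*-≤-∑ P? []       T c c≤T = z≤n
length-filter-*-≤-∑ P? (x ∷ xs) T c c≤T with P? x
... | yes px = +-mono-≤ (c≤T x px) (length-filter-*-≤-∑ P? xs T c c≤T)
... | no  _  = ≤-trans (length-filter-*-≤-∑ P? xs T c c≤T) (m≤n+m _ (T x))

∑-allVecsOf : (xs : List A) (n : ℕ) (f : Vec A (suc n) → ℕ) →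
  ∑ (allVecsOf xs (suc n)) f ≡ ∑ xs (λ x → ∑ (allVecsOf xs n) (λ v → f (x ∷ v)))
∑-allVecsOf xs n f = trans (∑-concatMap _ xs f)
  (∑-cong xs (λ x → ∑-map (x ∷_) (allVecsOf xs n) f))

∑-allVecs : (n : ℕ) (f : F2^ (suc n) → ℕ) →
  ∑ (allVecs (suc n)) f ≡ ∑ (allVecs n) (λ y → f (true ∷ y)) + ∑ (allVecs n) (λ y → f (false ∷ y))
∑-allVecs n f = trans (∑-concatMap (λ b → map (b ∷_) (allVecs n)) (true ∷ false ∷ []) f)
  (cong₂ _+_ (∑-map (true ∷_) (allVecs n) f)
    (trans (+-identityʳ _) (∑-map (false ∷_) (allVecs n) f)))

length-allVecs : (n : ℕ) → length (allVecs n) ≡ 2 ^ n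
length-allVecs zero    = refl
length-allVecs (suc n) = begin
  length (allVecs (suc n))                      ≡⟨ ∑-1 (allVecs (suc n)) ⟨
  ∑ (allVecs (suc n)) (λ _ → 1)                 ≡⟨ ∑-allVecs n (λ _ → 1) ⟩
  ∑ (allVecs n) (λ _ → 1) + ∑ (allVecs n) (λ _ → 1)
    ≡⟨ cong₂ _+_ e (trans e (sym (+-identityʳ _))) ⟩
  2 ^ suc n                                     ∎
  where
  open ≡-Reasoning
  e : ∑ (allVecs n) (λ _ → 1) ≡ 2 ^ n
  e = trans (∑-1 (allVecs n)) (length-allVecs n)

length-allVecsOf : (xs : List A) (n : ℕ) →
  length (allVecsOf xs (suc n)) ≡ length xs * length (allVecsOf xs n)
length-allVecsOf xs n = begin
  length (allVecsOf xs (suc n))                  ≡⟨ ∑-1 (allVecsOf xs (suc n)) ⟨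
  ∑ (allVecsOf xs (suc n)) (λ _ → 1)             ≡⟨ ∑-allVecsOf xs n (λ _ → 1) ⟩
  ∑ xs (λ _ → ∑ (allVecsOf xs n) (λ _ → 1))      ≡⟨ ∑-const xs _ ⟩
  length xs * ∑ (allVecsOf xs n) (λ _ → 1)       ≡⟨ cong (length xs *_) (∑-1 (allVecsOf xs n)) ⟩
  length xs * length (allVecsOf xs n)            ∎
  where open ≡-Reasoning

#LinMap : ℕ → ℕ → ℕ
#LinMap u i = length (allLinMaps u i)

#LinMap-suc : (u i : ℕ) → #LinMap u (suc i) ≡ 2 ^ u * #LinMap u i
#LinMap-suc u i = trans (length-allVecsOf (allVecs u) i)
  (cong (_* #LinMap u i) (length-allVecs u))

#LinMap>0 : (u i : ℕ) → 0 < #LinMap u i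
#LinMap>0 u zero    = s≤s z≤n
#LinMap>0 u (suc i) = subst (0 <_) (sym (#LinMap-suc u i))
  (*-mono-≤ (m^n>0 2 u) (#LinMap>0 u i))

-- Translations of the space 𝔽₂^i

infixl 6 _⊕_
_⊕_ : F2^ i → F2^ i → F2^ i
_⊕_ = zipWith _xor_

infixr 7 _·_
_·_ : Bool → F2^ i → F2^ i
b · []      = []
b · (c ∷ v) = (b ∧ c) ∷ (b · v)

⊕-comm : (x y : F2^ i) → x ⊕ y ≡ y ⊕ x
⊕-comm []      []      = refl
⊕-comm (b ∷ x) (c ∷ y) = cong₂ _∷_ (Bool.xor-comm b c) (⊕-comm x y)

⊕-cancelʳ : (x a : F2^ i) → x ⊕ a ⊕ a ≡ x
⊕-cancelʳ []      []      = refl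
⊕-cancelʳ (b ∷ x) (c ∷ a) = cong₂ _∷_ (lemma b c) (⊕-cancelʳ x a)
  where
  lemma : ∀ b c → (b xor c) xor c ≡ b
  lemma false false = refl
  lemma false true  = refl
  lemma true  false = refl
  lemma true  true  = refl

⊕-false· : (x a : F2^ i) → x ⊕ false · a ≡ x
⊕-false· []      []      = refl
⊕-false· (b ∷ x) (c ∷ a) = cong₂ _∷_ (Bool.xor-identityʳ b) (⊕-false· x a)

⊕-true· : (x a : F2^ i) → x ⊕ true · a ≡ x ⊕ a
⊕-true· []      []      = refl
⊕-true· (b ∷ x) (c ∷ a) = cong (_ ∷_) (⊕-true· x a)

-- Adding `a` permutes the space: a leading bit `true` of `a` swaps the two halves of the sum, a bit
-- `false` keeps them.
∑-translate : (a : F2^ i) (f : F2^ i → ℕ) →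
  ∑ (allVecs i) (λ y → f (y ⊕ a)) ≡ ∑ (allVecs i) f
∑-translate []          f = refl
∑-translate {suc i} (b ∷ a) f = begin
  ∑ (allVecs (suc i)) (λ y → f (y ⊕ (b ∷ a)))
    ≡⟨ ∑-allVecs i (λ y → f (y ⊕ (b ∷ a))) ⟩
  ∑ (allVecs i) (λ y → f (not b ∷ (y ⊕ a))) + ∑ (allVecs i) (λ y → f (b ∷ (y ⊕ a)))
    ≡⟨ cong₂ _+_ (∑-translate a (λ y → f (not b ∷ y))) (∑-translate a (λ y → f (b ∷ y))) ⟩
  ∑ (allVecs i) (λ y → f (not b ∷ y)) + ∑ (allVecs i) (λ y → f (b ∷ y))
    ≡⟨ flip b ⟩
  ∑ (allVecs i) (λ y → f (true ∷ y)) + ∑ (allVecs i) (λ y → f (false ∷ y))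
    ≡⟨ ∑-allVecs i f ⟨
  ∑ (allVecs (suc i)) f ∎
  where
  open ≡-Reasoning
  flip : ∀ b → ∑ (allVecs i) (λ y → f (not b ∷ y)) + ∑ (allVecs i) (λ y → f (b ∷ y))
    ≡ ∑ (allVecs i) (λ y → f (true ∷ y)) + ∑ (allVecs i) (λ y → f (false ∷ y))
  flip false = refl
  flip true  = +-comm (∑ (allVecs i) (λ y → f (false ∷ y))) _

-- For fixed `y` the point `y ⊕ a` runs over the whole space with `a`, so the double sum factors.
-- This decouples the two bins that a random line merges.
∑-convolution : (f g : F2^ i → ℕ) →
  ∑ (allVecs i) (λ a → ∑ (allVecs i) (λ y → f y * g (y ⊕ a)))
    ≡ ∑ (allVecs i) f * ∑ (allVecs i) g
∑-convolution {i} f g = begin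
  ∑ V (λ a → ∑ V (λ y → f y * g (y ⊕ a)))   ≡⟨ ∑-swap V V (λ a y → f y * g (y ⊕ a)) ⟩
  ∑ V (λ y → ∑ V (λ a → f y * g (y ⊕ a)))   ≡⟨ ∑-cong V inner ⟩
  ∑ V (λ y → f y * ∑ V g)                   ≡⟨ ∑-*ʳ V f (∑ V g) ⟩
  ∑ V f * ∑ V g                             ∎
  where
  open ≡-Reasoning
  V : List (F2^ i)
  V = allVecs i
  inner : ∀ y → ∑ V (λ a → f y * g (y ⊕ a)) ≡ f y * ∑ V g
  inner y = trans (∑-*ˡ V (f y) (λ a → g (y ⊕ a)))
    (cong (f y *_) (trans (∑-cong V (λ a → cong g (⊕-comm y a))) (∑-translate y g)))

-- Quotients by a random line

-- The matrix h + a ρᵀ.  Writing π_a : 𝔽₂^(1+i) → 𝔽₂^i for the projection (b , y) ↦ y + b a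
-- with kernel spanned by (1 , a), it is the composite of π_a with the map whose rows are ρ ∷ h.
shear : F2^ i → F2^ u → LinMap u i → LinMap u i
shear []      ρ []      = []
shear (b ∷ a) ρ (r ∷ h) = (r ⊕ b · ρ) ∷ shear a ρ h

dot-⊕· : (b : Bool) (ρ r x : F2^ u) → dot (r ⊕ b · ρ) x ≡ dot r x xor (dot ρ x ∧ b)
dot-⊕· b []      []      []      = refl
dot-⊕· b (c ∷ ρ) (d ∷ r) (e ∷ x) =
  trans (cong (((d xor (b ∧ c)) ∧ e) xor_) (dot-⊕· b ρ r x)) (lemma b c d e (dot ρ x) (dot r x))
  where
  lemma : ∀ b c d e s t →
    ((d xor (b ∧ c)) ∧ e) xor (t xor (s ∧ b)) ≡ ((d ∧ e) xor t) xor (((c ∧ e) xor s) ∧ b)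
  lemma false c d e s t rewrite Bool.∧-zeroʳ s | Bool.∧-zeroʳ ((c ∧ e) xor s)
    | Bool.xor-identityʳ d | Bool.xor-identityʳ t | Bool.xor-identityʳ ((d ∧ e) xor t) = refl
  lemma true c d false s t rewrite Bool.∧-zeroʳ (d xor c) | Bool.∧-zeroʳ d | Bool.∧-zeroʳ c = refl
  lemma true c d true s t rewrite Bool.∧-identityʳ (d xor c) | Bool.∧-identityʳ d
    | Bool.∧-identityʳ c | Bool.∧-identityʳ s | Bool.∧-identityʳ (c xor s) = begin
    (d xor c) xor (t xor s) ≡⟨ Bool.xor-assoc d c (t xor s) ⟩
    d xor (c xor (t xor s)) ≡⟨ cong (d xor_) (Bool.xor-assoc c t s) ⟨
    d xor ((c xor t) xor s) ≡⟨ cong (λ z → d xor (z xor s)) (Bool.xor-comm c t) ⟩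
    d xor ((t xor c) xor s) ≡⟨ cong (d xor_) (Bool.xor-assoc t c s) ⟩
    d xor (t xor (c xor s)) ≡⟨ Bool.xor-assoc d t (c xor s) ⟨
    (d xor t) xor (c xor s) ∎
    where open ≡-Reasoning

-- `dot ρ x` is the leading coordinate of `apply (ρ ∷ h) x`, so this identifies the sheared map with
-- π_a after `ρ ∷ h`.
apply-shear : (a : F2^ i) (ρ : F2^ u) (h : LinMap u i) (x : F2^ u) →
  apply (shear a ρ h) x ≡ apply h x ⊕ dot ρ x · a
apply-shear []      ρ []      x = refl
apply-shear (b ∷ a) ρ (r ∷ h) x = cong₂ _∷_ (dot-⊕· b ρ r x) (apply-shear a ρ h x)

-- For fixed `a` and `ρ`, shearing translates every row by a fixed vector, hence permutes the
-- matrices.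
∑-shear : (a : F2^ i) (ρ : F2^ u) (f : LinMap u i → ℕ) →
  ∑ (allLinMaps u i) (λ h → f (shear a ρ h)) ≡ ∑ (allLinMaps u i) f
∑-shear []      ρ f = refl
∑-shear {suc i} {u} (b ∷ a) ρ f = begin
  ∑ (allLinMaps u (suc i)) (λ h → f (shear (b ∷ a) ρ h))
    ≡⟨ ∑-allVecsOf (allVecs u) i _ ⟩
  ∑ (allVecs u) (λ r → ∑ (allLinMaps u i) (λ h → f ((r ⊕ b · ρ) ∷ shear a ρ h)))
    ≡⟨ ∑-cong (allVecs u) (λ r → ∑-shear a ρ (λ h → f ((r ⊕ b · ρ) ∷ h))) ⟩
  ∑ (allVecs u) (λ r → ∑ (allLinMaps u i) (λ h → f ((r ⊕ b · ρ) ∷ h)))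
    ≡⟨ ∑-translate (b · ρ) (λ r → ∑ (allLinMaps u i) (λ h → f (r ∷ h))) ⟩
  ∑ (allVecs u) (λ r → ∑ (allLinMaps u i) (λ h → f (r ∷ h)))
    ≡⟨ ∑-allVecsOf (allVecs u) i f ⟨
  ∑ (allLinMaps u (suc i)) f ∎
  where open ≡-Reasoning

-- The coupling of consecutive levels: for uniform `ρ`, `h` and `a` the sheared map is uniform, so a
-- mean over maps into 𝔽₂^i can be taken by drawing `ρ ∷ h` first and the line afterwards.
∑-shear-average : (f : LinMap u i → ℕ) →
  ∑ (allVecs u) (λ ρ → ∑ (allLinMaps u i) (λ h → ∑ (allVecs i) (λ a → f (shear a ρ h))))
    ≡ 2 ^ u * (2 ^ i * ∑ (allLinMaps u i) f)
∑-shear-average {u} {i} f = begin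
  ∑ (allVecs u) (λ ρ → ∑ (allLinMaps u i) (λ h → ∑ (allVecs i) (λ a → f (shear a ρ h))))
    ≡⟨ ∑-cong (allVecs u) inner ⟩
  ∑ (allVecs u) (λ _ → 2 ^ i * ∑ (allLinMaps u i) f)
    ≡⟨ ∑-const (allVecs u) _ ⟩
  length (allVecs u) * (2 ^ i * ∑ (allLinMaps u i) f)
    ≡⟨ cong (_* (2 ^ i * ∑ (allLinMaps u i) f)) (length-allVecs u) ⟩
  2 ^ u * (2 ^ i * ∑ (allLinMaps u i) f) ∎
  where
  open ≡-Reasoning
  inner : ∀ ρ → ∑ (allLinMaps u i) (λ h → ∑ (allVecs i) (λ a → f (shear a ρ h)))
    ≡ 2 ^ i * ∑ (allLinMaps u i) f
  inner ρ = begin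
    ∑ (allLinMaps u i) (λ h → ∑ (allVecs i) (λ a → f (shear a ρ h)))
      ≡⟨ ∑-swap (allLinMaps u i) (allVecs i) (λ h a → f (shear a ρ h)) ⟩
    ∑ (allVecs i) (λ a → ∑ (allLinMaps u i) (λ h → f (shear a ρ h)))
      ≡⟨ ∑-cong (allVecs i) (λ a → ∑-shear a ρ f) ⟩
    ∑ (allVecs i) (λ _ → ∑ (allLinMaps u i) f)
      ≡⟨ ∑-const (allVecs i) _ ⟩
    length (allVecs i) * ∑ (allLinMaps u i) f
      ≡⟨ cong (_* ∑ (allLinMaps u i) f) (length-allVecs i) ⟩
    2 ^ i * ∑ (allLinMaps u i) f ∎

-- Elementary inequalities

m*m≤n*n⇒m≤n : ∀ {m n} → m * m ≤ n * n → m ≤ n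
m*m≤n*n⇒m≤n {m} {n} mm≤nn with m ≤? n
... | yes m≤n = m≤n
... | no  m≰n = contradiction mm≤nn (<⇒≱ (*-mono-< (≰⇒> m≰n) (≰⇒> m≰n)))

m^o≤n^o⇒m≤n : ∀ {m n} o → 1 ≤ o → m ^ o ≤ n ^ o → m ≤ n
m^o≤n^o⇒m≤n {m} {n} (suc o) _ m^o≤n^o with m ≤? n
... | yes m≤n = m≤n
... | no  m≰n = contradiction m^o≤n^o (<⇒≱ (^-monoˡ-< (suc o) (≰⇒> m≰n)))

n<2^n : ∀ n → n < 2 ^ n
n<2^n zero    = s≤s z≤n
n<2^n (suc n) = +-mono-≤ (m^n>0 2 n) (≤-trans (n<2^n n) (m≤m+n (2 ^ n) 0))

-- AM-GM: the two sides differ by the square of the gap `d` between `m` and `n`.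
4mn≤[n+m]² : ∀ m n → 4 * (m * n) ≤ (n + m) * (n + m)
4mn≤[n+m]² m n with ≤-total m n
... | inj₁ m≤n with d , refl ← m≤n⇒∃[o]m+o≡n m≤n =
  subst (4 * (m * (m + d)) ≤_) (sym (eq m d)) (m≤m+n _ (d * d))
  where
  eq : ∀ m d → (m + d + m) * (m + d + m) ≡ 4 * (m * (m + d)) + d * d
  eq = solve-∀
... | inj₂ n≤m with d , refl ← m≤n⇒∃[o]m+o≡n n≤m =
  subst (4 * ((n + d) * n) ≤_) (sym (eq n d)) (m≤m+n _ (d * d))
  where
  eq : ∀ n d → (n + (n + d)) * (n + (n + d)) ≡ 4 * ((n + d) * n) + d * d
  eq = solve-∀

sq : ℕ → ℕ
sq n = n * n

sq-mono : ∀ {m n} → m ≤ n → sq m ≤ sq n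
sq-mono m≤n = *-mono-≤ m≤n m≤n

-- The chord of t ↦ min(t, b)² from a to b has slope a + b ≤ 2b and dominates the function on t ≥ a.
sq-⊓-chord : ∀ a w b → a ≤ b → sq ((a + w) ⊓ b) ≤ sq a + 2 * (b * w)
sq-⊓-chord a w b a≤b with ≤-total ((a + w) ⊓ b) a
... | inj₁ c≤a = ≤-trans (sq-mono c≤a) (m≤m+n (sq a) _)
... | inj₂ a≤c with d , a+d≡c ← m≤n⇒∃[o]m+o≡n a≤c = begin
  sq ((a + w) ⊓ b)        ≡⟨ cong sq a+d≡c ⟨
  sq (a + d)              ≡⟨ eq a d ⟩
  sq a + (a + (a + d)) * d ≤⟨ +-monoʳ-≤ (sq a) (*-mono-≤ (+-mono-≤ a≤b a+d≤b) d≤w) ⟩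
  sq a + (b + b) * w      ≡⟨ cong (sq a +_) (eq′ b w) ⟩
  sq a + 2 * (b * w)      ∎
  where
  open ≤-Reasoning
  eq : ∀ a d → (a + d) * (a + d) ≡ a * a + (a + (a + d)) * d
  eq = solve-∀
  eq′ : ∀ b w → (b + b) * w ≡ 2 * (b * w)
  eq′ = solve-∀
  a+d≤b : a + d ≤ b
  a+d≤b = subst (_≤ b) (sym a+d≡c) (m⊓n≤n (a + w) b)
  d≤w : d ≤ w
  d≤w = +-cancelˡ-≤ a d w (subst (_≤ a + w) (sym a+d≡c) (m⊓n≤m (a + w) b))

-- One witness serves both conclusions, so that the excess compared with the total is that of a bin
-- of maximum load.
max-attained : (xs : List A) (f g : A → ℕ) → 0 < length xs →
  ∃ λ x → foldr _⊔_ 0 (map f xs) ≡ f x × g x ≤ ∑ xs g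
max-attained (x ∷ [])          f g _ = x , ⊔-identityʳ (f x) , m≤m+n (g x) 0
max-attained (x ∷ xs@(_ ∷ _)) f g _
  with x′ , max≡ , g≤ ← max-attained xs f g (s≤s z≤n) | ≤-total (f x) (foldr _⊔_ 0 (map f xs))
... | inj₁ fx≤max = x′ , trans (m≤n⇒m⊔n≡n fx≤max) max≡ , ≤-trans g≤ (m≤n+m _ (g x))
... | inj₂ max≤fx = x , m≥n⇒m⊔n≡m max≤fx , m≤m+n (g x) _

-- The expected number of collisions

𝟙 : {P : Set} → Dec P → ℕ
𝟙 p? = if does p? then 1 else 0

length-filter-∑ : {P : A → Set} (P? : Decidable P) (xs : List A) →
  length (filter P? xs) ≡ ∑ xs (λ x → 𝟙 (P? x))
length-filter-∑ P? []       = refl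
length-filter-∑ P? (x ∷ xs) with P? x
... | yes _ = cong suc (length-filter-∑ P? xs)
... | no  _ = length-filter-∑ P? xs

∑-𝟙-≟v : (z : F2^ i) → ∑ (allVecs i) (λ y → 𝟙 (z ≟v y)) ≡ 1
∑-𝟙-≟v []      = refl
∑-𝟙-≟v {suc i} (true ∷ z) = trans (∑-allVecs i _)
  (cong₂ _+_ (∑-𝟙-≟v z) (trans (∑-const (allVecs i) 0) (*-zeroʳ (length (allVecs i)))))
∑-𝟙-≟v {suc i} (false ∷ z) = trans (∑-allVecs i _)
  (cong₂ _+_ (trans (∑-const (allVecs i) 0) (*-zeroʳ (length (allVecs i)))) (∑-𝟙-≟v z))

-- If the leading bits of the two points differ, flipping the leading bit of `r` toggles agreement,
-- so exactly half of all `r` agree. If they coincide, the tails are still distinct and decide.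
2*∑-dot-agree : (x x′ : F2^ u) → x ≢ x′ →
  2 * ∑ (allVecs u) (λ r → 𝟙 (dot r x Bool.≟ dot r x′)) ≡ 2 ^ u
2*∑-dot-agree []      []        x≢x′ = contradiction refl x≢x′
2*∑-dot-agree {suc u} (b ∷ x) (b′ ∷ x′) x≢x′ =
  cong (2 *_) (trans (∑-allVecs u _) (trans (sym (∑-+ V _ _)) (bits b b′ x≢x′)))
  where
  V : List (F2^ u)
  V = allVecs u
  agree : Bool → Bool → ℕ
  agree s t = 𝟙 (s Bool.≟ t)
  agree-not : ∀ s t → agree (not s) (not t) ≡ agree s t
  agree-not false false = refl
  agree-not false true  = refl
  agree-not true  false = refl
  agree-not true  true  = refl
  flipped : ∀ s t → agree (not s) t + agree s t ≡ 1
  flipped false false = refl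
  flipped false true  = refl
  flipped true  false = refl
  flipped true  true  = refl
  flipped′ : ∀ s t → agree s (not t) + agree s t ≡ 1
  flipped′ false false = refl
  flipped′ false true  = refl
  flipped′ true  false = refl
  flipped′ true  true  = refl
  ones : ∑ V (λ _ → 1) ≡ 2 ^ u
  ones = trans (∑-1 V) (length-allVecs u)
  twice : x ≢ x′ → ∑ V (λ r → agree (dot r x) (dot r x′) + agree (dot r x) (dot r x′)) ≡ 2 ^ u
  twice ne = trans (∑-+ V same same)
    (trans (cong (∑ V same +_) (sym (+-identityʳ (∑ V same)))) (2*∑-dot-agree x x′ ne))
    where
    same : F2^ u → ℕ
    same r = agree (dot r x) (dot r x′)
  bits : ∀ b b′ → b ∷ x ≢ b′ ∷ x′ →
    ∑ V (λ r → agree (dot (true ∷ r) (b ∷ x)) (dot (true ∷ r) (b′ ∷ x′))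
             + agree (dot (false ∷ r) (b ∷ x)) (dot (false ∷ r) (b′ ∷ x′))) ≡ 2 ^ u
  bits false false ne = twice (λ e → ne (cong (false ∷_) e))
  bits true  true  ne = trans
    (∑-cong V (λ r → cong (_+ agree (dot r x) (dot r x′)) (agree-not (dot r x) (dot r x′))))
    (twice (λ e → ne (cong (true ∷_) e)))
  bits false true  ne = trans (∑-cong V (λ r → flipped′ (dot r x) (dot r x′))) ones
  bits true  false ne = trans (∑-cong V (λ r → flipped (dot r x) (dot r x′))) ones

-- The rows are independent and each agrees with probability 1/2, so two distinct points collide
-- with probability 1 / 2^i.
2^i*∑-collision : (i : ℕ) (x x′ : F2^ u) → x ≢ x′ →
  2 ^ i * ∑ (allLinMaps u i) (λ h → 𝟙 (apply h x ≟v apply h x′)) ≡ #LinMap u i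
2^i*∑-collision zero    x x′ x≢x′ = refl
2^i*∑-collision {u} (suc i) x x′ x≢x′ = begin
  2 ^ suc i * ∑ (allLinMaps u (suc i)) (λ h → 𝟙 (apply h x ≟v apply h x′))
    ≡⟨ cong (2 ^ suc i *_) (∑-allVecsOf (allVecs u) i _) ⟩
  2 ^ suc i * ∑ (allVecs u) (λ r → ∑ L (λ h → 𝟙 (apply (r ∷ h) x ≟v apply (r ∷ h) x′)))
    ≡⟨ cong (2 ^ suc i *_) (∑-cong (allVecs u) factor) ⟩
  2 ^ suc i * ∑ (allVecs u) (λ r → row r * rest)
    ≡⟨ cong (2 ^ suc i *_) (∑-*ʳ (allVecs u) row rest) ⟩
  2 * 2 ^ i * (∑ (allVecs u) row * rest)
    ≡⟨ interchange *-commutativeSemigroup 2 (2 ^ i) (∑ (allVecs u) row) rest ⟩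
  2 * ∑ (allVecs u) row * (2 ^ i * rest)
    ≡⟨ cong₂ _*_ (2*∑-dot-agree x x′ x≢x′) (2^i*∑-collision i x x′ x≢x′) ⟩
  2 ^ u * #LinMap u i
    ≡⟨ #LinMap-suc u i ⟨
  #LinMap u (suc i) ∎
  where
  open ≡-Reasoning
  L : List (LinMap u i)
  L = allLinMaps u i
  row : F2^ u → ℕ
  row r = 𝟙 (dot r x Bool.≟ dot r x′)
  rest : ℕ
  rest = ∑ L (λ h → 𝟙 (apply h x ≟v apply h x′))
  -- Equality of the images is decided from the first row on, so its indicator is that of the first
  -- row times that of the remaining rows.
  factor : ∀ r → ∑ L (λ h → 𝟙 (apply (r ∷ h) x ≟v apply (r ∷ h) x′)) ≡ row r * rest
  factor r with dot r x Bool.≟ dot r x′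
  ... | yes _ = sym (+-identityʳ rest)
  ... | no  _ = trans (∑-const L 0) (*-zeroʳ (length L))

-- Each colliding pair is counted once, at its earlier member; the value is 0 exactly when the
-- images of the listed points are pairwise distinct.
collisions : List (F2^ u) → LinMap u i → ℕ
collisions []      h = 0
collisions (x ∷ S) h = load h S (apply h x) + collisions S h

∑-load : (i : ℕ) (x : F2^ u) (S : List (F2^ u)) → All (x ≢_) S →
  2 ^ i * ∑ (allLinMaps u i) (λ h → load h S (apply h x)) ≡ length S * #LinMap u i
∑-load {u} i x S x∉S = begin
  2 ^ i * ∑ L (λ h → load h S (apply h x))
    ≡⟨ cong (2 ^ i *_) (∑-cong L (λ h → length-filter-∑ (λ x′ → apply h x′ ≟v apply h x) S)) ⟩
  2 ^ i * ∑ L (λ h → ∑ S (λ x′ → 𝟙 (apply h x′ ≟v apply h x)))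
    ≡⟨ cong (2 ^ i *_) (∑-swap L S (λ h x′ → 𝟙 (apply h x′ ≟v apply h x))) ⟩
  2 ^ i * ∑ S (λ x′ → ∑ L (λ h → 𝟙 (apply h x′ ≟v apply h x)))
    ≡⟨ distribute S x∉S ⟩
  length S * #LinMap u i ∎
  where
  open ≡-Reasoning
  L : List (LinMap u i)
  L = allLinMaps u i
  distribute : ∀ S → All (x ≢_) S →
    2 ^ i * ∑ S (λ x′ → ∑ L (λ h → 𝟙 (apply h x′ ≟v apply h x))) ≡ length S * #LinMap u i
  distribute []       []          = *-zeroʳ (2 ^ i)
  distribute (x′ ∷ S) (x≢x′ ∷ x∉S) = trans (*-distribˡ-+ (2 ^ i) _ _)
    (cong₂ _+_ (2^i*∑-collision i x′ x (x≢x′ ∘ sym)) (distribute S x∉S))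

-- By linearity of expectation each of the m (m - 1) / 2 pairs contributes 1 / 2^i. The cruder m² /
-- 2^i still tends to 0 as `i` grows.
∑-collisions : (i : ℕ) (S : List (F2^ u)) → Unique S →
  2 ^ i * ∑ (allLinMaps u i) (collisions S) ≤ sq (length S) * #LinMap u i
∑-collisions {u} i []      []            = ≤-reflexive
  (trans (cong (2 ^ i *_) (trans (∑-const (allLinMaps u i) 0) (*-zeroʳ (#LinMap u i)))) (*-zeroʳ (2 ^ i)))
∑-collisions {u} i (x ∷ S) (x∉S ∷ uniq) = begin
  2 ^ i * ∑ L (λ h → load h S (apply h x) + collisions S h)
    ≡⟨ cong (2 ^ i *_) (∑-+ L _ _) ⟩
  2 ^ i * (∑ L (λ h → load h S (apply h x)) + ∑ L (collisions S))
    ≡⟨ *-distribˡ-+ (2 ^ i) _ _ ⟩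
  2 ^ i * ∑ L (λ h → load h S (apply h x)) + 2 ^ i * ∑ L (collisions S)
    ≤⟨ +-mono-≤ (≤-reflexive (∑-load i x S x∉S)) (∑-collisions i S uniq) ⟩
  s * N + sq s * N
    ≤⟨ m≤m+n _ (s * N + N) ⟩
  s * N + sq s * N + (s * N + N)
    ≡⟨ regroup s N ⟩
  sq (suc s) * N ∎
  where
  open ≤-Reasoning
  L : List (LinMap u i)
  L = allLinMaps u i
  s N : ℕ
  s = length S
  N = #LinMap u i
  regroup : ∀ s N → s * N + s * s * N + (s * N + N) ≡ (1 + s) * (1 + s) * N
  regroup = solve-∀

-- Exponential weights of the bins

module Weights (cn cd : ℕ) where

  δ : F2^ i → F2^ i → ℕ
  δ z y = if does (z ≟v y) then cn else cd

  -- This is c^load scaled by `cd ^ length S`, as `weight-load` shows. One factor per point lets the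
  -- merging of bins be checked point by point.
  weight : LinMap u i → List (F2^ u) → F2^ i → ℕ
  weight h []      y = 1
  weight h (x ∷ S) y = δ (apply h x) y * weight h S y

  weight-load : (h : LinMap u i) (S : List (F2^ u)) (y : F2^ i) →
    weight h S y * cd ^ load h S y ≡ cn ^ load h S y * cd ^ length S
  weight-load h []      y = refl
  weight-load h (x ∷ S) y with apply h x ≟v y | weight-load h S y
  ... | yes _ | ih = lemma cn cd (weight h S y) (cd ^ load h S y) (cn ^ load h S y) (cd ^ length S) ih
    where
    lemma : ∀ n d w dˡ nˡ e → w * dˡ ≡ nˡ * e → n * w * (d * dˡ) ≡ n * nˡ * (d * e)
    lemma n d w dˡ nˡ e eq = trans (l n d w dˡ) (trans (cong (n * d *_) eq) (sym (l n d nˡ e)))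
      where
      l : ∀ n d a b → n * a * (d * b) ≡ n * d * (a * b)
      l = solve-∀
  ... | no  _ | ih = lemma cd (weight h S y) (cd ^ load h S y) (cn ^ load h S y) (cd ^ length S) ih
    where
    lemma : ∀ d w dˡ nˡ e → w * dˡ ≡ nˡ * e → d * w * dˡ ≡ nˡ * (d * e)
    lemma d w dˡ nˡ e eq = trans (*-assoc d w dˡ) (trans (cong (d *_) eq) (l d nˡ e))
      where
      l : ∀ d a b → d * (a * b) ≡ a * (d * b)
      l = solve-∀

  δ-⊕ : (z y a : F2^ i) → δ (z ⊕ a) y ≡ δ z (y ⊕ a)
  δ-⊕ z y a with (z ⊕ a) ≟v y | z ≟v (y ⊕ a)
  ... | yes _  | yes _  = refl
  ... | no  _  | no  _  = refl
  ... | yes p  | no ¬q = contradiction (trans (sym (⊕-cancelʳ z a)) (cong (_⊕ a) p)) ¬q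
  ... | no  ¬p | yes q  = contradiction (trans (cong (_⊕ a) q) (⊕-cancelʳ y a)) ¬p

  -- The fibre of π_a over `y` consists of (0 , y) and (1 , y + a). The point (b , z) can only lie
  -- in the bin with leading bit `b`, so the other factor is `cd`.
  δ-split : (b : Bool) (z y a : F2^ i) →
    δ (z ⊕ b · a) y * cd ≡ δ (b ∷ z) (false ∷ y) * δ (b ∷ z) (true ∷ (y ⊕ a))
  δ-split false z y a = cong (λ v → δ v y * cd) (⊕-false· z a)
  δ-split true  z y a = begin
    δ (z ⊕ true · a) y * cd ≡⟨ cong (λ v → δ v y * cd) (⊕-true· z a) ⟩
    δ (z ⊕ a) y * cd        ≡⟨ cong (_* cd) (δ-⊕ z y a) ⟩
    δ z (y ⊕ a) * cd        ≡⟨ *-comm (δ z (y ⊕ a)) cd ⟩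
    cd * δ z (y ⊕ a)        ∎
    where open ≡-Reasoning

  -- Merging two bins adds their loads, so the powers of c multiply. The factor `cd ^ length S`
  -- matches the scaling, which occurs twice on the right.
  weight-shear : (a : F2^ i) (ρ : F2^ u) (h : LinMap u i) (S : List (F2^ u)) (y : F2^ i) →
    weight (shear a ρ h) S y * cd ^ length S
      ≡ weight (ρ ∷ h) S (false ∷ y) * weight (ρ ∷ h) S (true ∷ (y ⊕ a))
  weight-shear a ρ h []      y = refl
  weight-shear a ρ h (x ∷ S) y = begin
    δ (apply (shear a ρ h) x) y * weight (shear a ρ h) S y * (cd * cd ^ length S)
      ≡⟨ cong (λ z → δ z y * weight (shear a ρ h) S y * (cd * cd ^ length S)) (apply-shear a ρ h x) ⟩
    δ (apply h x ⊕ dot ρ x · a) y * weight (shear a ρ h) S y * (cd * cd ^ length S)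
      ≡⟨ *-interchange (δ (apply h x ⊕ dot ρ x · a) y) _ cd _ ⟩
    δ (apply h x ⊕ dot ρ x · a) y * cd * (weight (shear a ρ h) S y * cd ^ length S)
      ≡⟨ cong₂ _*_ (δ-split (dot ρ x) (apply h x) y a) (weight-shear a ρ h S y) ⟩
    δ₀ * δ₁ * (weight (ρ ∷ h) S (false ∷ y) * weight (ρ ∷ h) S (true ∷ (y ⊕ a)))
      ≡⟨ *-interchange δ₀ δ₁ (weight (ρ ∷ h) S (false ∷ y)) _ ⟩
    δ₀ * weight (ρ ∷ h) S (false ∷ y) * (δ₁ * weight (ρ ∷ h) S (true ∷ (y ⊕ a))) ∎
    where
    open ≡-Reasoning
    δ₀ δ₁ : ℕ
    δ₀ = δ (apply (ρ ∷ h) x) (false ∷ y)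
    δ₁ = δ (apply (ρ ∷ h) x) (true ∷ (y ⊕ a))
    *-interchange : ∀ a b c d → (a * b) * (c * d) ≡ (a * c) * (b * d)
    *-interchange = interchange *-commutativeSemigroup

  -- The term c^load - 1, scaled by `cd ^ length S`. Truncated subtraction loses nothing when
  -- `cd ≤ cn`, by `cd^≤weight`.
  excess : LinMap u i → List (F2^ u) → F2^ i → ℕ
  excess h S y = weight h S y ∸ cd ^ length S

  totalExcess : List (F2^ u) → LinMap u i → ℕ
  totalExcess {i = i} S h = ∑ (allVecs i) (excess h S)

  load≡0⇒weight : (h : LinMap u i) (S : List (F2^ u)) (y : F2^ i) →
    load h S y ≡ 0 → weight h S y ≡ cd ^ length S
  load≡0⇒weight h S y load≡0 = begin
    weight h S y                        ≡⟨ *-identityʳ _ ⟨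
    weight h S y * cd ^ 0               ≡⟨ cong (λ k → weight h S y * cd ^ k) load≡0 ⟨
    weight h S y * cd ^ load h S y      ≡⟨ weight-load h S y ⟩
    cn ^ load h S y * cd ^ length S     ≡⟨ cong (λ k → cn ^ k * cd ^ length S) load≡0 ⟩
    1 * cd ^ length S                   ≡⟨ *-identityˡ _ ⟩
    cd ^ length S                       ∎
    where open ≡-Reasoning

  -- A point entering an empty bin raises its excess from 0 to c - 1; every other bin is only
  -- rescaled by `cd`.
  excess-∷ : (h : LinMap u i) (x : F2^ u) (S : List (F2^ u)) → load h S (apply h x) ≡ 0 →
    (y : F2^ i) →
    excess h (x ∷ S) y ≤ cd * excess h S y + 𝟙 (apply h x ≟v y) * ((cn ∸ cd) * cd ^ length S)
  excess-∷ h x S load≡0 y with apply h x ≟v y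
  ... | no _ = ≤-trans (≤-reflexive (sym (*-distribˡ-∸ cd (weight h S y) (cd ^ length S)))) (m≤m+n _ 0)
  ... | yes refl = begin
    cn * weight h S y ∸ cd * D      ≡⟨ cong (λ w → cn * w ∸ cd * D) (load≡0⇒weight h S y load≡0) ⟩
    cn * D ∸ cd * D                 ≡⟨ *-distribʳ-∸ D cn cd ⟨
    (cn ∸ cd) * D                   ≡⟨ +-identityʳ _ ⟨
    (cn ∸ cd) * D + 0               ≤⟨ m≤n+m _ (cd * excess h S y) ⟩
    cd * excess h S y + ((cn ∸ cd) * D + 0) ∎
    where
    open ≤-Reasoning
    D : ℕ
    D = cd ^ length S

  -- Without collisions each point is alone in its bin and contributes c - 1, so X is at most (c -
  -- 1) m. The factor `cd` on the left clears the denominator of c.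
  totalExcess-injective : (S : List (F2^ u)) (h : LinMap u i) → collisions S h ≡ 0 →
    cd * totalExcess S h ≤ length S * (cn ∸ cd) * cd ^ length S
  totalExcess-injective {i = i} []      h _ = ≤-reflexive (trans
    (cong (cd *_) (trans (∑-const (allVecs i) 0) (*-zeroʳ (length (allVecs i))))) (*-zeroʳ cd))
  totalExcess-injective {i = i} (x ∷ S) h coll≡0 = begin
    cd * ∑ V (excess h (x ∷ S))
      ≤⟨ *-monoʳ-≤ cd (∑-mono V (excess-∷ h x S (m+n≡0⇒m≡0 _ coll≡0))) ⟩
    cd * ∑ V (λ y → cd * excess h S y + 𝟙 (apply h x ≟v y) * (c * D))
      ≡⟨ cong (cd *_) (trans (∑-+ V _ _) (cong₂ _+_ (∑-*ˡ V cd (excess h S))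
           (trans (∑-*ʳ V (λ y → 𝟙 (apply h x ≟v y)) (c * D)) (cong (_* (c * D)) (∑-𝟙-≟v (apply h x)))))) ⟩
    cd * (cd * totalExcess S h + 1 * (c * D))
      ≤⟨ *-monoʳ-≤ cd (+-monoˡ-≤ _ (totalExcess-injective S h (m+n≡0⇒n≡0 (load h S (apply h x)) coll≡0))) ⟩
    cd * (length S * c * D + 1 * (c * D))
      ≡⟨ regroup cd (length S) c D ⟩
    suc (length S) * c * (cd * D) ∎
    where
    open ≤-Reasoning
    V : List (F2^ i)
    V = allVecs i
    c D : ℕ
    c = cn ∸ cd
    D = cd ^ length S
    regroup : ∀ e s c D → e * (s * c * D + 1 * (c * D)) ≡ (1 + s) * c * (e * D)
    regroup = solve-∀

  module _ (cd≤cn : cd ≤ cn) where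

    cd≤δ : (z y : F2^ i) → cd ≤ δ z y
    cd≤δ z y with z ≟v y
    ... | yes _ = cd≤cn
    ... | no  _ = ≤-refl

    cd^≤weight : (h : LinMap u i) (S : List (F2^ u)) (y : F2^ i) → cd ^ length S ≤ weight h S y
    cd^≤weight h []      y = ≤-refl
    cd^≤weight h (x ∷ S) y = *-mono-≤ (cd≤δ (apply h x) y) (cd^≤weight h S y)

    -- The scaled form of (1 + g₀) (1 + g₁) - 1 = g₀ g₁ + g₁ + g₀.
    excess-shear : (a : F2^ i) (ρ : F2^ u) (h : LinMap u i) (S : List (F2^ u)) (y : F2^ i) →
      let g₀ = excess (ρ ∷ h) S (false ∷ y)
          g₁ = excess (ρ ∷ h) S (true ∷ (y ⊕ a))
      in cd ^ length S * excess (shear a ρ h) S y ≡ g₀ * g₁ + cd ^ length S * (g₁ + g₀)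
    excess-shear a ρ h S y = begin
      D * (weight (shear a ρ h) S y ∸ D)    ≡⟨ *-distribˡ-∸ D (weight (shear a ρ h) S y) D ⟩
      D * weight (shear a ρ h) S y ∸ D * D  ≡⟨ cong (_∸ D * D) (*-comm D _) ⟩
      weight (shear a ρ h) S y * D ∸ D * D  ≡⟨ cong (_∸ D * D) (weight-shear a ρ h S y) ⟩
      w₀ * w₁ ∸ D * D                       ≡⟨ cong₂ (λ s t → s * t ∸ D * D)
                                                 (m∸n+n≡m (cd^≤weight (ρ ∷ h) S (false ∷ y)))
                                                 (m∸n+n≡m (cd^≤weight (ρ ∷ h) S (true ∷ (y ⊕ a)))) ⟨
      (g₀ + D) * (g₁ + D) ∸ D * D           ≡⟨ cong (_∸ D * D) (expand g₀ g₁ D) ⟩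
      g₀ * g₁ + D * (g₁ + g₀) + D * D ∸ D * D ≡⟨ m+n∸n≡m _ (D * D) ⟩
      g₀ * g₁ + D * (g₁ + g₀)               ∎
      where
      open ≡-Reasoning
      D w₀ w₁ g₀ g₁ : ℕ
      D  = cd ^ length S
      w₀ = weight (ρ ∷ h) S (false ∷ y)
      w₁ = weight (ρ ∷ h) S (true ∷ (y ⊕ a))
      g₀ = w₀ ∸ D
      g₁ = w₁ ∸ D
      expand : ∀ g₀ g₁ D → (g₀ + D) * (g₁ + D) ≡ g₀ * g₁ + D * (g₁ + g₀) + D * D
      expand = solve-∀

    -- The growth of the total excess when bins are merged

    -- The increase W for the line spanned by (1 , a), scaled by the square of `cd ^ length S`.
    pairing : (S : List (F2^ u)) (ρ : F2^ u) (h : LinMap u i) → F2^ i → ℕ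
    pairing {i = i} S ρ h a =
      ∑ (allVecs i) (λ y → excess (ρ ∷ h) S (false ∷ y) * excess (ρ ∷ h) S (true ∷ (y ⊕ a)))

    -- The linear terms of `excess-shear` visit every bin of `ρ ∷ h` once and restore its total
    -- excess; the products are the increase.
    totalExcess-shear : (a : F2^ i) (ρ : F2^ u) (h : LinMap u i) (S : List (F2^ u)) →
      cd ^ length S * totalExcess S (shear a ρ h)
        ≡ pairing S ρ h a + cd ^ length S * totalExcess S (ρ ∷ h)
    totalExcess-shear {i} a ρ h S = begin
      D * ∑ V (excess (shear a ρ h) S)
        ≡⟨ ∑-*ˡ V D _ ⟨
      ∑ V (λ y → D * excess (shear a ρ h) S y)
        ≡⟨ ∑-cong V (excess-shear a ρ h S) ⟩
      ∑ V (λ y → g₀ y * g₁ (y ⊕ a) + D * (g₁ (y ⊕ a) + g₀ y))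
        ≡⟨ ∑-+ V _ _ ⟩
      pairing S ρ h a + ∑ V (λ y → D * (g₁ (y ⊕ a) + g₀ y))
        ≡⟨ cong (pairing S ρ h a +_) (∑-*ˡ V D _) ⟩
      pairing S ρ h a + D * ∑ V (λ y → g₁ (y ⊕ a) + g₀ y)
        ≡⟨ cong (λ s → pairing S ρ h a + D * s) (∑-+ V _ _) ⟩
      pairing S ρ h a + D * (∑ V (λ y → g₁ (y ⊕ a)) + ∑ V g₀)
        ≡⟨ cong (λ s → pairing S ρ h a + D * (s + ∑ V g₀)) (∑-translate a g₁) ⟩
      pairing S ρ h a + D * (∑ V g₁ + ∑ V g₀)
        ≡⟨ cong (λ s → pairing S ρ h a + D * s) (∑-allVecs i (excess (ρ ∷ h) S)) ⟨
      pairing S ρ h a + D * totalExcess S (ρ ∷ h) ∎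
      where
      open ≡-Reasoning
      V : List (F2^ i)
      V = allVecs i
      D : ℕ
      D = cd ^ length S
      g₀ g₁ : F2^ i → ℕ
      g₀ y = excess (ρ ∷ h) S (false ∷ y)
      g₁ y = excess (ρ ∷ h) S (true ∷ y)

    -- Summing over `a` separates the products into the excess of one half of the bins times that of
    -- the other; AM-GM compares this with their sum.
    4*∑-pairing : (S : List (F2^ u)) (ρ : F2^ u) (h : LinMap u i) →
      4 * ∑ (allVecs i) (pairing S ρ h) ≤ totalExcess S (ρ ∷ h) * totalExcess S (ρ ∷ h)
    4*∑-pairing {i = i} S ρ h = begin
      4 * ∑ V (pairing S ρ h)     ≡⟨ cong (4 *_) (∑-convolution g₀ g₁) ⟩
      4 * (∑ V g₀ * ∑ V g₁)       ≤⟨ 4mn≤[n+m]² (∑ V g₀) (∑ V g₁) ⟩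
      (∑ V g₁ + ∑ V g₀) * (∑ V g₁ + ∑ V g₀)
        ≡⟨ cong₂ _*_ (∑-allVecs i (excess (ρ ∷ h) S)) (∑-allVecs i (excess (ρ ∷ h) S)) ⟨
      totalExcess S (ρ ∷ h) * totalExcess S (ρ ∷ h) ∎
      where
      open ≤-Reasoning
      V : List (F2^ i)
      V = allVecs i
      g₀ g₁ : F2^ i → ℕ
      g₀ y = excess (ρ ∷ h) S (false ∷ y)
      g₁ y = excess (ρ ∷ h) S (true ∷ y)

    -- The truncated second moment and one step of its recursion

    -- With D = `cd ^ length S`, X = `totalExcess S h` / D and B = P / Q, this is (D P)² min(X / B ,
    -- 1)².
    truncated : List (F2^ u) → ℕ → ℕ → LinMap u i → ℕ
    truncated S P Q h = sq ((Q * totalExcess S h) ⊓ (cd ^ length S * P))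

    module _ .{{_ : NonZero cd}} (S : List (F2^ u)) where

      private
        D : ℕ
        D = cd ^ length S
        instance
          D≢0 : NonZero D
          D≢0 = m^n≢0 cd (length S)

      -- The chord bound from `Q * totalExcess S (ρ ∷ h)`; `pairing` is D times the increase of the
      -- total excess.
      truncated-shear-≤ : (P Q : ℕ) (a : F2^ i) (ρ : F2^ u) (h : LinMap u i) →
        Q * totalExcess S (ρ ∷ h) ≤ D * P →
        truncated S P Q (shear a ρ h)
          ≤ sq (Q * totalExcess S (ρ ∷ h)) + 2 * (P * Q) * pairing S ρ h a
      truncated-shear-≤ P Q a ρ h QX≤DP = begin
        sq ((Q * Xₐ) ⊓ (D * P))               ≡⟨ cong (λ t → sq ((Q * t) ⊓ (D * P))) X+e≡Xₐ ⟨
        sq ((Q * (X + e)) ⊓ (D * P))          ≡⟨ cong (λ t → sq (t ⊓ (D * P))) (*-distribˡ-+ Q X e) ⟩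
        sq ((Q * X + Q * e) ⊓ (D * P))        ≤⟨ sq-⊓-chord (Q * X) (Q * e) (D * P) QX≤DP ⟩
        sq (Q * X) + 2 * (D * P * (Q * e))    ≡⟨ cong (sq (Q * X) +_) (regroup D P Q e) ⟩
        sq (Q * X) + 2 * (P * Q) * (D * e)    ≡⟨ cong (λ t → sq (Q * X) + 2 * (P * Q) * t) De≡W ⟩
        sq (Q * X) + 2 * (P * Q) * pairing S ρ h a ∎
        where
        open ≤-Reasoning
        X Xₐ e : ℕ
        X  = totalExcess S (ρ ∷ h)
        Xₐ = totalExcess S (shear a ρ h)
        e  = Xₐ ∸ X
        -- The pairing term is nonnegative, so `Xₐ ∸ X` is a true difference.
        X≤Xₐ : X ≤ Xₐ
        X≤Xₐ = *-cancelˡ-≤ D (subst (D * X ≤_) (sym (totalExcess-shear a ρ h S)) (m≤n+m (D * X) _))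
        X+e≡Xₐ : X + e ≡ Xₐ
        X+e≡Xₐ = m+[n∸m]≡n X≤Xₐ
        regroup : ∀ D P Q e → 2 * (D * P * (Q * e)) ≡ 2 * (P * Q) * (D * e)
        regroup = solve-∀
        De≡W : D * e ≡ pairing S ρ h a
        De≡W = +-cancelʳ-≡ (D * X) (D * e) (pairing S ρ h a) (trans (+-comm (D * e) (D * X))
          (trans (sym (*-distribˡ-+ D X e))
            (trans (cong (D *_) X+e≡Xₐ) (totalExcess-shear a ρ h S))))

      -- The hypothesis is B′² (1 + B / 2^(i+1)) ≤ B² without denominators. If X ≥ B′ the right side
      -- is saturated and the trivial bound `D * P` suffices; otherwise the chord bound is averaged
      -- over `a`.
      ∑-truncated-shear-≤ : (P Q P′ Q′ : ℕ) .{{_ : NonZero P′}} →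
        sq P′ * ((2 ^ suc i * Q + P) * Q) ≤ sq Q′ * sq P * 2 ^ suc i →
        (ρ : F2^ u) (h : LinMap u i) →
        ∑ (allVecs i) (λ a → truncated S P Q (shear a ρ h)) * sq P′
          ≤ 2 ^ i * (sq P * truncated S P′ Q′ (ρ ∷ h))
      ∑-truncated-shear-≤ {i} P Q P′ Q′ hyp ρ h with ≤-total (D * P′) (Q′ * totalExcess S (ρ ∷ h))
      ... | inj₁ DP′≤Q′X = begin
        ∑ (allVecs i) (λ a → truncated S P Q (shear a ρ h)) * sq P′
          ≤⟨ *-monoˡ-≤ (sq P′) (∑-mono (allVecs i) (λ a → sq-mono (m⊓n≤n (Q * totalExcess S (shear a ρ h)) (D * P)))) ⟩
        ∑ (allVecs i) (λ _ → sq (D * P)) * sq P′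
          ≡⟨ cong (_* sq P′) (trans (∑-const (allVecs i) (sq (D * P))) (cong (_* sq (D * P)) (length-allVecs i))) ⟩
        2 ^ i * sq (D * P) * sq P′
          ≡⟨ regroup (2 ^ i) D P P′ ⟩
        2 ^ i * (sq P * sq (D * P′))
          ≡⟨ cong (λ t → 2 ^ i * (sq P * sq t)) (m≥n⇒m⊓n≡n DP′≤Q′X) ⟨
        2 ^ i * (sq P * truncated S P′ Q′ (ρ ∷ h)) ∎
        where
        open ≤-Reasoning
        regroup : ∀ z D P P′ → z * (D * P * (D * P)) * (P′ * P′) ≡ z * (P * P * (D * P′ * (D * P′)))
        regroup = solve-∀
      -- Doubling turns 2^i into 2^(i+1) and supplies the 4 in `4*∑-pairing`.
      ... | inj₂ Q′X≤DP′ = *-cancelˡ-≤ 2 (begin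
        2 * (∑ V (λ a → truncated S P Q (shear a ρ h)) * sq P′)
          ≤⟨ *-monoʳ-≤ 2 (*-monoˡ-≤ (sq P′) (∑-mono V (λ a → truncated-shear-≤ P Q a ρ h QX≤DP))) ⟩
        2 * (∑ V (λ a → sq (Q * X) + 2 * (P * Q) * pairing S ρ h a) * sq P′)
          ≡⟨ cong (λ t → 2 * (t * sq P′)) (trans (∑-+ V _ _) (cong₂ _+_
               (trans (∑-const V (sq (Q * X))) (cong (_* sq (Q * X)) (length-allVecs i)))
               (∑-*ˡ V (2 * (P * Q)) (pairing S ρ h)))) ⟩
        2 * ((2 ^ i * sq (Q * X) + 2 * (P * Q) * ∑ V (pairing S ρ h)) * sq P′)
          ≡⟨ regroup₁ (2 ^ i) Q X P (∑ V (pairing S ρ h)) P′ ⟩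
        (2 ^ suc i * sq (Q * X) + P * Q * (4 * ∑ V (pairing S ρ h))) * sq P′
          ≤⟨ *-monoˡ-≤ (sq P′) (+-monoʳ-≤ (2 ^ suc i * sq (Q * X)) (*-monoʳ-≤ (P * Q) (4*∑-pairing S ρ h))) ⟩
        (2 ^ suc i * sq (Q * X) + P * Q * (X * X)) * sq P′
          ≡⟨ regroup₂ (2 ^ suc i) Q X P P′ ⟩
        sq X * (sq P′ * ((2 ^ suc i * Q + P) * Q))
          ≤⟨ *-monoʳ-≤ (sq X) hyp ⟩
        sq X * (sq Q′ * sq P * 2 ^ suc i)
          ≡⟨ regroup₃ X Q′ P (2 ^ i) ⟩
        2 * (2 ^ i * (sq P * sq (Q′ * X)))
          ≡⟨ cong (λ t → 2 * (2 ^ i * (sq P * sq t))) (m≤n⇒m⊓n≡m Q′X≤DP′) ⟨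
        2 * (2 ^ i * (sq P * truncated S P′ Q′ (ρ ∷ h))) ∎)
        where
        open ≤-Reasoning
        V : List (F2^ i)
        V = allVecs i
        X : ℕ
        X = totalExcess S (ρ ∷ h)
        regroup₁ : ∀ z Q X P W P′ → 2 * ((z * (Q * X * (Q * X)) + 2 * (P * Q) * W) * (P′ * P′))
          ≡ ((2 * z) * (Q * X * (Q * X)) + P * Q * (4 * W)) * (P′ * P′)
        regroup₁ = solve-∀
        regroup₂ : ∀ z Q X P P′ → (z * (Q * X * (Q * X)) + P * Q * (X * X)) * (P′ * P′)
          ≡ X * X * (P′ * P′ * ((z * Q + P) * Q))
        regroup₂ = solve-∀
        regroup₃ : ∀ X Q′ P z → X * X * (Q′ * Q′ * (P * P) * (2 * z)) ≡ 2 * (z * (P * P * (Q′ * X * (Q′ * X))))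
        regroup₃ = solve-∀
        -- Dropping the summand `P` from the hypothesis leaves B′ ≤ B; hence X ≤ B′ gives X ≤ B,
        -- where the chord bound applies.
        P′Q≤Q′P : P′ * Q ≤ Q′ * P
        P′Q≤Q′P = m*m≤n*n⇒m≤n (*-cancelʳ-≤ _ _ (2 ^ suc i) {{m^n≢0 2 (suc i)}} (begin
          P′ * Q * (P′ * Q) * 2 ^ suc i             ≡⟨ e₁ P′ Q (2 ^ suc i) ⟩
          sq P′ * (2 ^ suc i * Q * Q)               ≤⟨ *-monoʳ-≤ (sq P′) (*-monoˡ-≤ Q (m≤m+n (2 ^ suc i * Q) P)) ⟩
          sq P′ * ((2 ^ suc i * Q + P) * Q)         ≤⟨ hyp ⟩
          sq Q′ * sq P * 2 ^ suc i                  ≡⟨ cong (_* 2 ^ suc i) (e₂ Q′ P) ⟩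
          Q′ * P * (Q′ * P) * 2 ^ suc i             ∎))
          where
          e₁ : ∀ P′ Q z → P′ * Q * (P′ * Q) * z ≡ P′ * P′ * (z * Q * Q)
          e₁ = solve-∀
          e₂ : ∀ Q′ P → Q′ * Q′ * (P * P) ≡ Q′ * P * (Q′ * P)
          e₂ = solve-∀
        QX≤DP : Q * X ≤ D * P
        QX≤DP = *-cancelˡ-≤ P′ (begin
          P′ * (Q * X)   ≡⟨ *-assoc P′ Q X ⟨
          P′ * Q * X     ≤⟨ *-monoˡ-≤ X P′Q≤Q′P ⟩
          Q′ * P * X     ≡⟨ e₁ Q′ P X ⟩
          P * (Q′ * X)   ≤⟨ *-monoʳ-≤ P Q′X≤DP′ ⟩
          P * (D * P′)   ≡⟨ e₂ P D P′ ⟩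
          P′ * (D * P)   ∎)
          where
          e₁ : ∀ Q′ P X → Q′ * P * X ≡ P * (Q′ * X)
          e₁ = solve-∀
          e₂ : ∀ P D P′ → P * (D * P′) ≡ P′ * (D * P)
          e₂ = solve-∀

      -- Summed over `ρ` and `h`, the left side becomes a sum over maps into 𝔽₂^i by
      -- `∑-shear-average`, while on the right `ρ ∷ h` enumerates the maps into 𝔽₂^(1+i).
      ∑-truncated-step : (i P Q P′ Q′ : ℕ) .{{_ : NonZero P′}} →
        sq P′ * ((2 ^ suc i * Q + P) * Q) ≤ sq Q′ * sq P * 2 ^ suc i →
        2 ^ u * ∑ (allLinMaps u i) (truncated S P Q) * sq P′
          ≤ sq P * ∑ (allLinMaps u (suc i)) (truncated S P′ Q′)
      ∑-truncated-step i P Q P′ Q′ hyp = *-cancelˡ-≤ (2 ^ i) {{m^n≢0 2 i}} (begin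
        2 ^ i * (2 ^ u * ∑ L (truncated S P Q) * sq P′)
          ≡⟨ regroup (2 ^ i) (2 ^ u) _ (sq P′) ⟩
        2 ^ u * (2 ^ i * ∑ L (truncated S P Q)) * sq P′
          ≡⟨ cong (_* sq P′) (∑-shear-average {i = i} (truncated S P Q)) ⟨
        ∑ (allVecs u) (λ ρ → ∑ L (λ h → ∑ (allVecs i) (λ a → truncated S P Q (shear a ρ h)))) * sq P′
          ≡⟨ trans (∑-cong (allVecs u) (λ ρ → ∑-*ʳ L _ (sq P′))) (∑-*ʳ (allVecs u) _ (sq P′)) ⟨
        ∑ (allVecs u) (λ ρ → ∑ L (λ h → ∑ (allVecs i) (λ a → truncated S P Q (shear a ρ h)) * sq P′))
          ≤⟨ ∑-mono (allVecs u) (λ ρ → ∑-mono L (∑-truncated-shear-≤ P Q P′ Q′ hyp ρ)) ⟩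
        ∑ (allVecs u) (λ ρ → ∑ L (λ h → 2 ^ i * (sq P * truncated S P′ Q′ (ρ ∷ h))))
          ≡⟨ ∑-cong (allVecs u) (λ ρ → trans (∑-*ˡ L (2 ^ i) _) (cong (2 ^ i *_) (∑-*ˡ L (sq P) _))) ⟩
        ∑ (allVecs u) (λ ρ → 2 ^ i * (sq P * ∑ L (λ h → truncated S P′ Q′ (ρ ∷ h))))
          ≡⟨ trans (∑-*ˡ (allVecs u) (2 ^ i) _) (cong (2 ^ i *_) (∑-*ˡ (allVecs u) (sq P) _)) ⟩
        2 ^ i * (sq P * ∑ (allVecs u) (λ ρ → ∑ L (λ h → truncated S P′ Q′ (ρ ∷ h))))
          ≡⟨ cong (λ t → 2 ^ i * (sq P * t)) (∑-allVecsOf (allVecs u) i (truncated S P′ Q′)) ⟨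
        2 ^ i * (sq P * ∑ (allLinMaps u (suc i)) (truncated S P′ Q′)) ∎)
        where
        open ≤-Reasoning
        L : List (LinMap u i)
        L = allLinMaps u i
        regroup : ∀ a b c d → a * (b * c * d) ≡ b * (a * c) * d
        regroup = solve-∀

      -- Solving the recursion for B

      -- C / #LinMap u ℓ is at most the average of min(X / B, 1)² over 𝔽₂^u → 𝔽₂^i,
      -- where X = totalExcess S h / D and B = P / Q.
      BoundedBy : (C ℓ i P Q : ℕ) → Set
      BoundedBy C ℓ i P Q =
        C * sq (D * P) * #LinMap u i ≤ #LinMap u ℓ * ∑ (allLinMaps u i) (truncated S P Q)

      BoundedBy-step : (C ℓ i P Q P′ Q′ : ℕ) .{{_ : NonZero P}} .{{_ : NonZero P′}} →
        sq P′ * ((2 ^ suc i * Q + P) * Q) ≤ sq Q′ * sq P * 2 ^ suc i →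
        BoundedBy C ℓ i P Q → BoundedBy C ℓ (suc i) P′ Q′
      BoundedBy-step C ℓ i P Q P′ Q′ hyp bound = *-cancelˡ-≤ (sq P) {{m*n≢0 P P}} (begin
        sq P * (C * sq (D * P′) * #LinMap u (suc i))
          ≡⟨ cong (λ N → sq P * (C * sq (D * P′) * N)) (#LinMap-suc u i) ⟩
        sq P * (C * sq (D * P′) * (2 ^ u * #LinMap u i))
          ≡⟨ regroup₁ P C D P′ (2 ^ u) (#LinMap u i) ⟩
        C * sq (D * P) * #LinMap u i * (2 ^ u * sq P′)
          ≤⟨ *-monoˡ-≤ (2 ^ u * sq P′) bound ⟩
        #LinMap u ℓ * V * (2 ^ u * sq P′)
          ≡⟨ regroup₂ (#LinMap u ℓ) V (2 ^ u) P′ ⟩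
        #LinMap u ℓ * (2 ^ u * V * sq P′)
          ≤⟨ *-monoʳ-≤ (#LinMap u ℓ) (∑-truncated-step i P Q P′ Q′ hyp) ⟩
        #LinMap u ℓ * (sq P * V′)
          ≡⟨ regroup₃ (#LinMap u ℓ) (sq P) V′ ⟩
        sq P * (#LinMap u ℓ * V′) ∎)
        where
        open ≤-Reasoning
        V V′ : ℕ
        V  = ∑ (allLinMaps u i) (truncated S P Q)
        V′ = ∑ (allLinMaps u (suc i)) (truncated S P′ Q′)
        regroup₁ : ∀ P C D P′ z N → P * P * (C * (D * P′ * (D * P′)) * (z * N))
          ≡ C * (D * P * (D * P)) * N * (z * (P′ * P′))
        regroup₁ = solve-∀
        regroup₂ : ∀ N V z P′ → N * V * (z * (P′ * P′)) ≡ N * (z * V * (P′ * P′))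
        regroup₂ = solve-∀
        regroup₃ : ∀ N p V → N * (p * V) ≡ p * (N * V)
        regroup₃ = solve-∀

      -- B = 2^i (E² - 1) / 2 can be traded for 2^(i+1) (E - 1) / 2.
      BoundedBy-sqrt : (C ℓ i e : ℕ) .{{_ : NonZero e}} →
        BoundedBy C ℓ i (2 ^ i * (sq (suc e) ∸ 1)) 2 → BoundedBy C ℓ (suc i) (2 ^ suc i * e) 2
      BoundedBy-sqrt C ℓ i e@(suc _) = BoundedBy-step C ℓ i (2 ^ i * (sq (suc e) ∸ 1)) 2 (2 ^ suc i * e) 2
        {{m*n≢0 (2 ^ i) (sq (suc e) ∸ 1) {{m^n≢0 2 i}}}} {{m*n≢0 (2 ^ suc i) e {{m^n≢0 2 (suc i)}}}}
        (subst (sq (2 ^ suc i * e) * ((2 ^ suc i * 2 + 2 ^ i * (sq (suc e) ∸ 1)) * 2) ≤_)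
          (gap (2 ^ i) e)
          -- The added term is the exact difference of the two sides, where E = 1 + e.
          (m≤m+n _ (16 * 2 ^ i * 2 ^ i * 2 ^ i * e * e * e)))
        where
        gap : ∀ z e →
          (2 * z * e) * (2 * z * e) * ((2 * z * 2 + z * (e + e * (1 + e))) * 2) + 16 * z * z * z * e * e * e
            ≡ 2 * 2 * ((z * (e + e * (1 + e))) * (z * (e + e * (1 + e)))) * (2 * z)
        gap = solve-∀

      -- Here E = 2^(2^J). Each square root halves its exponent, so J of them reach E = 2, where B =
      -- 2^(J+i) / 2.
      BoundedBy-tower : (C ℓ J i : ℕ) →
        BoundedBy C ℓ i (2 ^ i * (2 ^ (2 ^ J) ∸ 1)) 2 → BoundedBy C ℓ (J + i) (2 ^ (J + i)) 2
      BoundedBy-tower C ℓ zero    i = subst (λ P → BoundedBy C ℓ i P 2) (*-identityʳ (2 ^ i))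
      BoundedBy-tower C ℓ (suc J) i bound =
        subst (λ k → BoundedBy C ℓ k (2 ^ k) 2) (+-suc J i)
          (BoundedBy-tower C ℓ J (suc i)
            (BoundedBy-sqrt C ℓ i (E ∸ 1) {{>-nonZero (m<n⇒0<n∸m 1<E)}}
              (subst (λ X → BoundedBy C ℓ i (2 ^ i * (X ∸ 1)) 2) 2^2^[1+J]≡E² bound)))
        where
        E : ℕ
        E = 2 ^ (2 ^ J)
        1<E : 1 < E
        1<E = ^-monoʳ-≤ 2 {1} (m^n>0 2 J)
        2^2^[1+J]≡E² : 2 ^ (2 ^ suc J) ≡ sq (suc (E ∸ 1))
        2^2^[1+J]≡E² = trans (trans (cong (λ k → 2 ^ (2 ^ J + k)) (+-identityʳ (2 ^ J)))
          (^-distribˡ-+-* 2 (2 ^ J) (2 ^ J))) (cong sq (sym (m+[n∸m]≡n (<⇒≤ 1<E))))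

      denominator : ℕ → ℕ
      denominator zero    = 2
      denominator (suc t) = 2 * denominator t + 1

      1+denominator : ∀ t → suc (denominator t) ≡ 3 * 2 ^ t
      1+denominator zero    = refl
      1+denominator (suc t) = begin
        suc (2 * denominator t + 1)  ≡⟨ regroup (denominator t) ⟩
        2 * suc (denominator t)      ≡⟨ cong (2 *_) (1+denominator t) ⟩
        2 * (3 * 2 ^ t)              ≡⟨ regroup′ (2 ^ t) ⟩
        3 * 2 ^ suc t                ∎
        where
        open ≡-Reasoning
        regroup : ∀ d → 1 + (2 * d + 1) ≡ 2 * (1 + d)
        regroup = solve-∀
        regroup′ : ∀ z → 2 * (3 * z) ≡ 3 * (2 * z)
        regroup′ = solve-∀

      -- With y the current denominator, passing to 2 y + 1 satisfies the recursion because 4 y² ≤ 2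
      -- y (2 y + 1). By `1+denominator`, B stays above 2^i / 3 however many levels are added.
      BoundedBy-limit : (C ℓ i t : ℕ) →
        BoundedBy C ℓ i (2 ^ i) 2 → BoundedBy C ℓ (t + i) (2 ^ (t + i)) (denominator t)
      BoundedBy-limit C ℓ i zero    bound = bound
      BoundedBy-limit C ℓ i (suc t) bound =
        BoundedBy-step C ℓ (t + i) z y (2 * z) (2 * y + 1) {{m^n≢0 2 (t + i)}} {{m^n≢0 2 (suc t + i)}}
          (subst (sq (2 * z) * ((2 * z * y + z) * y) ≤_) (gap z y) (m≤m+n _ (2 * z * z * z * (2 * y + 1))))
          (BoundedBy-limit C ℓ i t bound)
        where
        z y : ℕ
        z = 2 ^ (t + i)
        y = denominator t
        gap : ∀ z y → 2 * z * (2 * z) * ((2 * z * y + z) * y) + 2 * z * z * z * (2 * y + 1)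
          ≡ (2 * y + 1) * (2 * y + 1) * (z * z) * (2 * z)
        gap = solve-∀

      -- Both ends of the recursion and the tail bound

      -- Without collisions X ≤ (c - 1) m ≤ M. Otherwise the truncation level is charged to one of
      -- the collisions.
      truncated-≤ : (M P Q : ℕ) → length S * (cn ∸ cd) ≤ cd * M → (h : LinMap u i) →
        truncated S P Q h ≤ sq (Q * (D * M)) + collisions S h * sq (D * P)
      truncated-≤ M P Q initial h with collisions S h in coll≡
      ... | zero  = ≤-trans (sq-mono (≤-trans (m⊓n≤m _ (D * P)) (*-monoʳ-≤ Q X≤DM))) (m≤m+n _ 0)
        where
        open ≤-Reasoning
        X≤DM : totalExcess S h ≤ D * M
        X≤DM = *-cancelˡ-≤ cd (begin
          cd * totalExcess S h          ≤⟨ totalExcess-injective S h coll≡ ⟩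
          length S * (cn ∸ cd) * D      ≤⟨ *-monoˡ-≤ D initial ⟩
          cd * M * D                    ≡⟨ *-assoc cd M D ⟩
          cd * (M * D)                  ≡⟨ cong (cd *_) (*-comm M D) ⟩
          cd * (D * M)                  ∎)
      ... | suc k = begin
        sq ((Q * totalExcess S h) ⊓ (D * P))   ≤⟨ sq-mono (m⊓n≤n (Q * totalExcess S h) (D * P)) ⟩
        sq (D * P)                             ≤⟨ m≤m+n (sq (D * P)) (k * sq (D * P)) ⟩
        suc k * sq (D * P)                     ≤⟨ m≤n+m _ (sq (Q * (D * M))) ⟩
        sq (Q * (D * M)) + suc k * sq (D * P)  ∎
        where open ≤-Reasoning

      -- The first summand comes from `totalExcess-injective`, the second from the expected number
      -- of collisions. The second grows only like 2^w against 4^w on the left.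
      BoundedBy-end : (C ℓ w M Q : ℕ) → Unique S → length S * (cn ∸ cd) ≤ cd * M →
        BoundedBy C ℓ w (2 ^ w) Q →
        C * sq (2 ^ w) ≤ #LinMap u ℓ * (sq (Q * M) + sq (length S) * 2 ^ w)
      BoundedBy-end C ℓ w M Q uniq initial bound =
        *-cancelˡ-≤ (sq D * N * z) {{m*n≢0 (sq D * N) z {{m*n≢0 (sq D) N {{m*n≢0 D D}} {{>-nonZero (#LinMap>0 u w)}}}} {{m^n≢0 2 w}}}} (begin
        sq D * N * z * (C * sq z)
          ≡⟨ regroup₁ D N z C ⟩
        C * sq (D * z) * N * z
          ≤⟨ *-monoˡ-≤ z bound ⟩
        Nℓ * ∑ L (truncated S z Q) * z
          ≤⟨ *-monoˡ-≤ z (*-monoʳ-≤ Nℓ (∑-mono L (truncated-≤ M z Q initial))) ⟩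
        Nℓ * ∑ L (λ h → sq (Q * (D * M)) + collisions S h * sq (D * z)) * z
          ≡⟨ cong (λ t → Nℓ * t * z) (trans (∑-+ L _ _)
               (cong₂ _+_ (∑-const L (sq (Q * (D * M)))) (∑-*ʳ L (collisions S) (sq (D * z))))) ⟩
        Nℓ * (N * sq (Q * (D * M)) + K * sq (D * z)) * z
          ≡⟨ regroup₂ Nℓ N Q D M K z ⟩
        Nℓ * (N * z * sq (Q * (D * M)) + z * K * sq (D * z))
          ≤⟨ *-monoʳ-≤ Nℓ (+-monoʳ-≤ _ (*-monoˡ-≤ (sq (D * z)) (∑-collisions w S uniq))) ⟩
        Nℓ * (N * z * sq (Q * (D * M)) + sq m * N * sq (D * z))
          ≡⟨ regroup₃ Nℓ N Q D M m z ⟩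
        sq D * N * z * (Nℓ * (sq (Q * M) + sq m * z)) ∎)
        where
        open ≤-Reasoning
        L : List (LinMap u w)
        L = allLinMaps u w
        N Nℓ z K m : ℕ
        N  = #LinMap u w
        Nℓ = #LinMap u ℓ
        z  = 2 ^ w
        K  = ∑ L (collisions S)
        m  = length S
        regroup₁ : ∀ D N z C → D * D * N * z * (C * (z * z)) ≡ C * (D * z * (D * z)) * N * z
        regroup₁ = solve-∀
        regroup₂ : ∀ Nℓ N Q D M K z →
          Nℓ * (N * (Q * (D * M) * (Q * (D * M))) + K * (D * z * (D * z))) * z
            ≡ Nℓ * (N * z * (Q * (D * M) * (Q * (D * M))) + z * K * (D * z * (D * z)))
        regroup₂ = solve-∀
        regroup₃ : ∀ Nℓ N Q D M m z →
          Nℓ * (N * z * (Q * (D * M) * (Q * (D * M))) + m * m * N * (D * z * (D * z)))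
            ≡ D * D * N * z * (Nℓ * (Q * M * (Q * M) + m * m * z))
        regroup₃ = solve-∀

      -- A bad map has a bin with c^load ≥ 2^ℓ X, whose excess is at least 2^ℓ X - 1 ≥ 2^ℓ (X - 1) =
      -- 2 B before scaling. So the truncated square is saturated at every bad map, and Markov's
      -- inequality counts them.
      BoundedBy-start : {ℓ : ℕ} {Bad : LinMap u ℓ → Set} (Bad? : Decidable Bad) (X : ℕ) →
        (∀ h → Bad h → cd ^ maxLoad h S * (2 ^ ℓ * X) ≤ cn ^ maxLoad h S) →
        BoundedBy (length (filter Bad? (allLinMaps u ℓ))) ℓ ℓ (2 ^ ℓ * (X ∸ 1)) 2
      BoundedBy-start {ℓ} {Bad} Bad? X heavy = ≤-trans
        (*-monoˡ-≤ (#LinMap u ℓ)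
          (length-filter-*-≤-∑ Bad? (allLinMaps u ℓ) (truncated S P 2) (sq (D * P)) saturated))
        (≤-reflexive (*-comm _ (#LinMap u ℓ)))
        where
        open ≤-Reasoning
        P : ℕ
        P = 2 ^ ℓ * (X ∸ 1)
        saturated : ∀ h → Bad h → sq (D * P) ≤ truncated S P 2 h
        saturated h bad
          with y , k≡ , ex≤ ← max-attained (allVecs ℓ) (load h S) (excess h S)
                                (subst (0 <_) (sym (length-allVecs ℓ)) (m^n>0 2 ℓ)) =
          sq-mono (⊓-glb (≤-trans DP≤X (m≤m+n (totalExcess S h) _)) ≤-refl)
          where
          k : ℕ
          k = load h S y
          2^ℓXD≤weight : 2 ^ ℓ * X * D ≤ weight h S y
          2^ℓXD≤weight = *-cancelˡ-≤ (cd ^ k) {{m^n≢0 cd k}} (begin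
            cd ^ k * (2 ^ ℓ * X * D)   ≡⟨ *-assoc (cd ^ k) (2 ^ ℓ * X) D ⟨
            cd ^ k * (2 ^ ℓ * X) * D   ≤⟨ *-monoˡ-≤ D (subst (λ j → cd ^ j * (2 ^ ℓ * X) ≤ cn ^ j) k≡ (heavy h bad)) ⟩
            cn ^ k * D                 ≡⟨ weight-load h S y ⟨
            weight h S y * cd ^ k      ≡⟨ *-comm (weight h S y) (cd ^ k) ⟩
            cd ^ k * weight h S y      ∎)
          DP≤X : D * P ≤ totalExcess S h
          DP≤X = begin
            D * (2 ^ ℓ * (X ∸ 1))      ≡⟨ cong (D *_) (*-distribˡ-∸ (2 ^ ℓ) X 1) ⟩
            D * (2 ^ ℓ * X ∸ 2 ^ ℓ * 1) ≤⟨ *-monoʳ-≤ D (∸-monoʳ-≤ (2 ^ ℓ * X) (*-mono-≤ (m^n>0 2 ℓ) ≤-refl)) ⟩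
            D * (2 ^ ℓ * X ∸ 1)        ≡⟨ *-distribˡ-∸ D (2 ^ ℓ * X) 1 ⟩
            D * (2 ^ ℓ * X) ∸ D * 1    ≡⟨ cong₂ _∸_ (*-comm D (2 ^ ℓ * X)) (*-identityʳ D) ⟩
            2 ^ ℓ * X * D ∸ D          ≤⟨ ∸-monoˡ-≤ D 2^ℓXD≤weight ⟩
            weight h S y ∸ D           ≤⟨ ex≤ ⟩
            totalExcess S h            ∎

      -- With w → ∞ the bound is 9 M² / (4^J 4^ℓ) ≤ 36 q² / s²; the slack up to 49 absorbs
      -- the probability that a map into 𝔽₂^w is not injective on S.
      tail-bound : {ℓ : ℕ} {Bad : LinMap u ℓ → Set} (Bad? : Decidable Bad) (J M s q : ℕ) →
        Unique S → length S * (cn ∸ cd) ≤ cd * M → 1 ≤ q →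
        s * M ≤ 2 ^ suc J * (q * 2 ^ ℓ) →
        (∀ h → Bad h → cd ^ maxLoad h S * (2 ^ ℓ * 2 ^ (2 ^ J)) ≤ cn ^ maxLoad h S) →
        length (filter Bad? (allLinMaps u ℓ)) * (s * s) ≤ 49 * (q * q) * #LinMap u ℓ
      tail-bound {ℓ} Bad? J M s q uniq initial 1≤q sM≤ heavy =
        *-cancelʳ-≤ _ _ (sq z) {{m*n≢0 z z {{m^n≢0 2 w}} {{m^n≢0 2 w}}}} (begin
        C * (s * s) * sq z
          ≡⟨ regroup₁ C s z ⟩
        C * sq z * sq s
          ≤⟨ *-monoˡ-≤ (sq s) (BoundedBy-end C ℓ w M Q uniq initial bounded) ⟩
        N * (sq (Q * M) + sq m * z) * sq s
          ≡⟨ regroup₂ N Q M m z s ⟩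
        N * (sq (Q * (s * M)) + sq (m * s) * z)
          ≤⟨ *-monoʳ-≤ N (+-mono-≤ (sq-mono (*-mono-≤ Q≤ sM≤)) (*-monoˡ-≤ z ms²≤z)) ⟩
        N * (sq (3 * a * (2 * b * (q * n))) + z * z)
          ≡⟨ cong (λ t → N * (sq (3 * a * (2 * b * (q * n))) + t * t)) z≡abn ⟩
        N * (sq (3 * a * (2 * b * (q * n))) + a * (b * n) * (a * (b * n)))
          ≤⟨ *-monoʳ-≤ N (+-monoʳ-≤ _ (m≤n*m _ (13 * (q * q)) {{m*n≢0 13 (q * q) {{_}} {{>-nonZero (*-mono-≤ 1≤q 1≤q)}}}})) ⟩
        N * (sq (3 * a * (2 * b * (q * n))) + 13 * (q * q) * (a * (b * n) * (a * (b * n))))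
          ≡⟨ regroup₃ N a b q n ⟩
        49 * (q * q) * N * sq (a * (b * n))
          ≡⟨ cong (λ t → 49 * (q * q) * N * sq t) z≡abn ⟨
        49 * (q * q) * N * sq z ∎)
        where
        open ≤-Reasoning
        C N m t w z a b n Q : ℕ
        C = length (filter Bad? (allLinMaps u ℓ))
        N = #LinMap u ℓ
        m = length S
        -- So many levels give (m s)² ≤ 2^t ≤ z, which bounds the collision term times s² by z².
        t = m * s + m * s
        w = t + (J + ℓ)
        z = 2 ^ w
        a = 2 ^ t
        b = 2 ^ J
        n = 2 ^ ℓ
        Q = denominator t
        z≡abn : z ≡ a * (b * n)
        z≡abn = trans (^-distribˡ-+-* 2 t (J + ℓ)) (cong (a *_) (^-distribˡ-+-* 2 J ℓ))
        bounded : BoundedBy C ℓ w z Q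
        bounded = BoundedBy-limit C ℓ (J + ℓ) t (BoundedBy-tower C ℓ J ℓ
          (BoundedBy-start Bad? (2 ^ (2 ^ J)) heavy))
        Q≤ : Q ≤ 3 * a
        Q≤ = subst (Q ≤_) (1+denominator t) (n≤1+n Q)
        ms²≤z : sq (m * s) ≤ z
        ms²≤z = begin
          sq (m * s)           ≤⟨ sq-mono (<⇒≤ (n<2^n (m * s))) ⟩
          sq (2 ^ (m * s))     ≡⟨ ^-distribˡ-+-* 2 (m * s) (m * s) ⟨
          2 ^ t                ≤⟨ ^-monoʳ-≤ 2 (m≤m+n t (J + ℓ)) ⟩
          2 ^ w                ∎
        regroup₁ : ∀ C s z → C * (s * s) * (z * z) ≡ C * (z * z) * (s * s)
        regroup₁ = solve-∀
        regroup₂ : ∀ N Q M m z s → N * (Q * M * (Q * M) + m * m * z) * (s * s)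
          ≡ N * (Q * (s * M) * (Q * (s * M)) + m * s * (m * s) * z)
        regroup₂ = solve-∀
        regroup₃ : ∀ N a b q n →
          N * (3 * a * (2 * b * (q * n)) * (3 * a * (2 * b * (q * n))) + 13 * (q * q) * (a * (b * n) * (a * (b * n))))
            ≡ 49 * (q * q) * N * (a * (b * n) * (a * (b * n)))
        regroup₃ = solve-∀

-- The scale J and the two regimes of opt

-- J is the integer part of log(b / a), found by descending from `b`, where `n<2^n` gives b < 2^b a.
-- The lower inequality makes bad bins heavy enough, the upper one enters the tail bound.
dyadic-scale : ∀ a b → 1 ≤ a → a ≤ b → ∃ λ J → 2 ^ J * a ≤ b × b ≤ 2 ^ suc J * a
dyadic-scale a b 1≤a a≤b = search b (<-≤-trans (n<2^n b) (m≤m*n (2 ^ b) a {{>-nonZero 1≤a}}))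
  where
  search : ∀ k → b < 2 ^ k * a → ∃ λ J → 2 ^ J * a ≤ b × b ≤ 2 ^ suc J * a
  search zero    b<a = contradiction (subst (b <_) (+-identityʳ a) b<a) (≤⇒≯ a≤b)
  search (suc k) b<2^[1+k]a with 2 ^ k * a ≤? b
  ... | yes 2^ka≤b = k , 2^ka≤b , <⇒≤ b<2^[1+k]a
  ... | no  2^ka≰b = search k (≰⇒> 2^ka≰b)

^-distribʳ-* : ∀ m n o → (m * n) ^ o ≡ m ^ o * n ^ o
^-distribʳ-* m n zero    = refl
^-distribʳ-* m n (suc o) = trans (cong (m * n *_) (^-distribʳ-* m n o))
  (interchange *-commutativeSemigroup m n (m ^ o) (n ^ o))

AtLeastROpt-sparse : ∀ k p q m ℓ → 2 * m ≤ 2 ^ ℓ * ℓ → AtLeastROpt k p q m ℓ →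
  2 ^ (p * ℓ) * m ^ (k * q) ≤ (2 ^ ℓ * ℓ) ^ (k * q)
AtLeastROpt-sparse k p q m ℓ 2m≤nℓ atLeast with 2 * m ≤? 2 ^ ℓ * ℓ
... | yes _     = atLeast
... | no  2m≰nℓ = contradiction 2m≤nℓ 2m≰nℓ

AtLeastROpt-dense : ∀ k p q m ℓ → 2 ^ ℓ * ℓ < 2 * m → AtLeastROpt k p q m ℓ →
  p * m ≤ k * q * 2 ^ ℓ
AtLeastROpt-dense k p q m ℓ nℓ<2m atLeast with 2 * m ≤? 2 ^ ℓ * ℓ
... | yes 2m≤nℓ = contradiction 2m≤nℓ (<⇒≱ nℓ<2m)
... | no  _     = atLeast

-- Here c = (n log n) / m, so that c^k ≥ n^r says exactly k ≥ r · opt.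
sparse-heavy : ∀ k p q s m ℓ J → 1 ≤ q → s + 2 * q ≡ p →
  2 ^ J * (q * 2 ^ ℓ) ≤ s * (2 ^ ℓ * ℓ) →
  2 ^ (p * ℓ) * m ^ (k * q) ≤ (2 ^ ℓ * ℓ) ^ (k * q) →
  m ^ k * (2 ^ ℓ * 2 ^ (2 ^ J)) ≤ (2 ^ ℓ * ℓ) ^ k
sparse-heavy k p q s m ℓ J 1≤q refl scale atLeast = m^o≤n^o⇒m≤n q 1≤q (begin
  (m ^ k * (2 ^ ℓ * 2 ^ (2 ^ J))) ^ q    ≡⟨ cong (λ x → (m ^ k * x) ^ q) (^-distribˡ-+-* 2 ℓ (2 ^ J)) ⟨
  (m ^ k * 2 ^ (ℓ + 2 ^ J)) ^ q          ≡⟨ ^-distribʳ-* (m ^ k) _ q ⟩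
  (m ^ k) ^ q * (2 ^ (ℓ + 2 ^ J)) ^ q    ≡⟨ cong₂ _*_ (^-*-assoc m k q) (^-*-assoc 2 (ℓ + 2 ^ J) q) ⟩
  m ^ (k * q) * 2 ^ ((ℓ + 2 ^ J) * q)    ≤⟨ *-monoʳ-≤ (m ^ (k * q)) (^-monoʳ-≤ 2 exponent) ⟩
  m ^ (k * q) * 2 ^ (p * ℓ)              ≡⟨ *-comm (m ^ (k * q)) _ ⟩
  2 ^ (p * ℓ) * m ^ (k * q)              ≤⟨ atLeast ⟩
  (2 ^ ℓ * ℓ) ^ (k * q)                  ≡⟨ ^-*-assoc (2 ^ ℓ * ℓ) k q ⟨
  ((2 ^ ℓ * ℓ) ^ k) ^ q                  ∎)
  where
  open ≤-Reasoning
  2^Jq≤sℓ : 2 ^ J * q ≤ s * ℓ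
  2^Jq≤sℓ = *-cancelʳ-≤ (2 ^ J * q) (s * ℓ) (2 ^ ℓ) {{m^n≢0 2 ℓ}} (begin
    2 ^ J * q * 2 ^ ℓ     ≡⟨ *-assoc (2 ^ J) q (2 ^ ℓ) ⟩
    2 ^ J * (q * 2 ^ ℓ)   ≤⟨ scale ⟩
    s * (2 ^ ℓ * ℓ)       ≡⟨ regroup s (2 ^ ℓ) ℓ ⟩
    s * ℓ * 2 ^ ℓ         ∎)
    where
    regroup : ∀ s n ℓ → s * (n * ℓ) ≡ s * ℓ * n
    regroup = solve-∀
  -- In p = s + 2 q the part `s` pays for 2^J, and one `q` pays for the factor 2^ℓ.
  exponent : (ℓ + 2 ^ J) * q ≤ (s + 2 * q) * ℓ
  exponent = begin
    (ℓ + 2 ^ J) * q              ≡⟨ *-distribʳ-+ q ℓ (2 ^ J) ⟩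
    ℓ * q + 2 ^ J * q            ≤⟨ +-monoʳ-≤ (ℓ * q) 2^Jq≤sℓ ⟩
    ℓ * q + s * ℓ                ≤⟨ m≤m+n _ (ℓ * q) ⟩
    ℓ * q + s * ℓ + ℓ * q        ≡⟨ regroup ℓ q s ⟩
    (s + 2 * q) * ℓ              ∎
    where
    regroup : ∀ ℓ q s → ℓ * q + s * ℓ + ℓ * q ≡ (s + 2 * q) * ℓ
    regroup = solve-∀

-- Here c = 2, so the claim amounts to k ≥ ℓ + 2^J. With n = 2^ℓ and p = s + 2 q, the part 2 q m of
-- p m covers ℓ since n ℓ ≤ 2 m, and s m covers 2^J by `scale`.
dense-heavy : ∀ k p q s m ℓ J → 1 ≤ q → s + 2 * q ≡ p →
  2 ^ ℓ * ℓ ≤ 2 * m → 2 ^ J * (q * 2 ^ ℓ) ≤ s * m → p * m ≤ k * q * 2 ^ ℓ →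
  1 ^ k * (2 ^ ℓ * 2 ^ (2 ^ J)) ≤ 2 ^ k
dense-heavy k p q s m ℓ J 1≤q refl nℓ≤2m scale atLeast = begin
  1 ^ k * (2 ^ ℓ * 2 ^ (2 ^ J))   ≡⟨ cong (_* (2 ^ ℓ * 2 ^ (2 ^ J))) (^-zeroˡ k) ⟩
  1 * (2 ^ ℓ * 2 ^ (2 ^ J))       ≡⟨ *-identityˡ _ ⟩
  2 ^ ℓ * 2 ^ (2 ^ J)             ≡⟨ ^-distribˡ-+-* 2 ℓ (2 ^ J) ⟨
  2 ^ (ℓ + 2 ^ J)                 ≤⟨ ^-monoʳ-≤ 2 exponent ⟩
  2 ^ k                           ∎
  where
  open ≤-Reasoning
  exponent : ℓ + 2 ^ J ≤ k
  exponent = *-cancelʳ-≤ (ℓ + 2 ^ J) k (q * 2 ^ ℓ) {{m*n≢0 q (2 ^ ℓ) {{>-nonZero 1≤q}} {{m^n≢0 2 ℓ}}}} (begin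
    (ℓ + 2 ^ J) * (q * 2 ^ ℓ)              ≡⟨ regroup₁ ℓ (2 ^ J) q (2 ^ ℓ) ⟩
    q * (2 ^ ℓ * ℓ) + 2 ^ J * (q * 2 ^ ℓ)  ≤⟨ +-mono-≤ (*-monoʳ-≤ q nℓ≤2m) scale ⟩
    q * (2 * m) + s * m                    ≡⟨ regroup₂ q m s ⟩
    (s + 2 * q) * m                        ≤⟨ atLeast ⟩
    k * q * 2 ^ ℓ                          ≡⟨ *-assoc k q (2 ^ ℓ) ⟩
    k * (q * 2 ^ ℓ)                        ∎)
    where
    regroup₁ : ∀ ℓ b q n → (ℓ + b) * (q * n) ≡ q * (n * ℓ) + b * (q * n)
    regroup₁ = solve-∀
    regroup₂ : ∀ q m s → q * (2 * m) + s * m ≡ (s + 2 * q) * m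
    regroup₂ = solve-∀

-- Combining the sparse and the dense regime

theorem1p3 : (u ℓ m : ℕ) → 1 ≤ ℓ → ℓ ≤ u → 1 ≤ m →
    (S : List (F2^ u)) → Unique S → length S ≡ m →
    (p q : ℕ) → 1 ≤ q → 6 * q ≤ p →
    badCount u ℓ S m p q * ((p ∸ 2 * q) * (p ∸ 2 * q))
    ≤ 49 * (q * q) * length (allLinMaps u ℓ)
theorem1p3 u ℓ m 1≤ℓ _ 1≤m S uniq refl p q 1≤q 6q≤p =
  [ sparse , dense ]′ (≤-<-connex (2 * m) (2 ^ ℓ * ℓ))
  where
  s : ℕ
  s = p ∸ 2 * q
  s+2q≡p : s + 2 * q ≡ p
  s+2q≡p = m∸n+n≡m (≤-trans (*-monoˡ-≤ q {2} {6} (s≤s (s≤s z≤n))) 6q≤p)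
  -- This secures the condition `a ≤ b` of `dyadic-scale` in both regimes.
  2q≤s : 2 * q ≤ s
  2q≤s = +-cancelʳ-≤ (2 * q) (2 * q) s (begin
    2 * q + 2 * q   ≡⟨ *-distribʳ-+ q 2 2 ⟨
    4 * q           ≤⟨ *-monoˡ-≤ q {4} {6} (s≤s (s≤s (s≤s (s≤s z≤n)))) ⟩
    6 * q           ≤⟨ 6q≤p ⟩
    p               ≡⟨ s+2q≡p ⟨
    s + 2 * q       ∎)
    where open ≤-Reasoning
  n≤nℓ : 2 ^ ℓ ≤ 2 ^ ℓ * ℓ
  n≤nℓ = m≤m*n (2 ^ ℓ) ℓ {{>-nonZero 1≤ℓ}}
  1≤qn : 1 ≤ q * 2 ^ ℓ
  1≤qn = *-mono-≤ 1≤q (m^n>0 2 ℓ)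
  Goal : Set
  Goal = badCount u ℓ S m p q * (s * s) ≤ 49 * (q * q) * length (allLinMaps u ℓ)

  sparse : 2 * m ≤ 2 ^ ℓ * ℓ → Goal
  sparse 2m≤nℓ
    with J , scale , scale′ ← dyadic-scale (q * 2 ^ ℓ) (s * (2 ^ ℓ * ℓ)) 1≤qn
           (*-mono-≤ (≤-trans (m≤m+n q _) 2q≤s) n≤nℓ) =
    -- With n = 2^ℓ, c = n ℓ / m and M = n ℓ, which is at least (c - 1) m.
    Weights.tail-bound (2 ^ ℓ * ℓ) m (≤-trans (m≤m+n m _) 2m≤nℓ) {{>-nonZero 1≤m}} S {ℓ}
      (λ h → atLeastROpt? (maxLoad h S) p q m ℓ) J (2 ^ ℓ * ℓ) s q uniq
      (*-monoʳ-≤ m (m∸n≤m (2 ^ ℓ * ℓ) m)) 1≤q scale′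
      (λ h bad → sparse-heavy (maxLoad h S) p q s m ℓ J 1≤q s+2q≡p scale
        (AtLeastROpt-sparse (maxLoad h S) p q m ℓ 2m≤nℓ bad))

  qn≤sm : 2 ^ ℓ * ℓ < 2 * m → q * 2 ^ ℓ ≤ s * m
  qn≤sm nℓ<2m = begin
    q * 2 ^ ℓ        ≤⟨ *-monoʳ-≤ q (≤-trans n≤nℓ (<⇒≤ nℓ<2m)) ⟩
    q * (2 * m)      ≡⟨ *-assoc q 2 m ⟨
    q * 2 * m        ≡⟨ cong (_* m) (*-comm q 2) ⟩
    2 * q * m        ≤⟨ *-monoˡ-≤ m 2q≤s ⟩
    s * m            ∎
    where open ≤-Reasoning

  dense : 2 ^ ℓ * ℓ < 2 * m → Goal
  dense nℓ<2m
    with J , scale , scale′ ← dyadic-scale (q * 2 ^ ℓ) (s * m) 1≤qn (qn≤sm nℓ<2m) =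
    -- c = 2, so that (c - 1) m = m serves as M.
    Weights.tail-bound 2 1 (s≤s z≤n) S {ℓ}
      (λ h → atLeastROpt? (maxLoad h S) p q m ℓ) J m s q uniq
      (≤-reflexive (*-comm m 1)) 1≤q scale′
      (λ h bad → dense-heavy (maxLoad h S) p q s m ℓ J 1≤q s+2q≡p (<⇒≤ nℓ<2m) scale
        (AtLeastROpt-dense (maxLoad h S) p q m ℓ nℓ<2m bad))
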